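{- Let $(T,\omega)$ and $(T',\omega')$ be weighted $2$-stars such that $M_{(T,\mathsf m_\omega)}(\mathbf z)=M_{(T',\mathsf m_{\omega'})}(\mathbf z)$. Then $(T,\omega)$ and $(T',\omega')$ are $\omega$-isomorphic. (That is, a weighted $2$-star can be reconstructed from its $M$-polynomial.)
   Context: A $2$-star is a tree obtained by taking two disjoint stars and joining their centers by an edge. A weighted tree is $(T,\omega)$, $\omega:V(T)\to\{1,2,\dots\}$; two weighted graphs are $\omega$-isomorphic if there is a graph isomorphism preserving weights. The marked version $\mathsf m_\omega$ gives vertex $v$ the mark $(\omega(v),0)$; marks are pairs $(w,d)$ with dot-sum $(w,d)\dotplus(w',d')=(w+w',d+d'+1)$. For a marked tree, $M_{(T,\mathsf m)}(\mathbf z)=\sum_{A\subseteq E(T)}\prod_C z_{\mathsf m(C)}$, where $C$ ranges over connected components of $(V(T),A)$, $\mathsf m(C)$ is the dot-sum of the marks of the vertices of $C$, and the $z_{w,d}$ are commuting indeterminates. -}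

module Defs where

open import Data.Nat using (ℕ; zero; suc; _+_; _≤_)
open import Data.Bool using (Bool; true; false; _∨_; _∧_; not; if_then_else_)
open import Data.Fin using (Fin; _<?_)
open import Data.Fin.Properties using (_≟_)
open import Data.List using (List; []; _∷_; map; filter; foldl; concatMap; _++_)
open import Data.Bool.ListAction using (any)
open import Data.List.Base using (allFin)
open import Data.Product using (_×_; _,_; proj₁; proj₂; Σ; ∃)
open import Data.Sum using (_⊎_)
open import Relation.Nullary using (¬_; does)
open import Relation.Binary.PropositionalEquality using (_≡_; _≢_)
open import Function.Bundles using (_↔_; Inverse)
open import Data.List.Relation.Binary.Permutation.Propositional using (_↭_)
open import Data.List.Relation.Binary.Permutation.Homogeneous using (Permutation)

record SimpleGraph (n : ℕ) : Set where
  field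
    adj    : Fin n → Fin n → Bool
    sym    : ∀ u v → adj u v ≡ adj v u
    irrefl : ∀ v → adj v v ≡ false
open SimpleGraph public

edges : ∀ {n} → SimpleGraph n → List (Fin n × Fin n)
edges {n} G =
  concatMap (λ i → map (λ j → (i , j))
                       (filter (λ j → i <? j) (filter (λ j → adj G i j Data.Bool.≟ true) (allFin n))))
            (allFin n)

subsets : {X : Set} → List X → List (List X)
subsets []       = [] ∷ []
subsets (x ∷ xs) = let r = subsets xs in r ++ map (x ∷_) r

_==_ : ∀ {n} → Fin n → Fin n → Bool
u == v = does (u ≟ v)

step : ∀ {n} → List (Fin n × Fin n) → (Fin n → Bool) → (Fin n → Bool)
step A S v = S v ∨ any (λ e → (S (proj₁ e) ∧ (proj₂ e == v)) ∨ (S (proj₂ e) ∧ (proj₁ e == v))) A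

iter : ℕ → {X : Set} → (X → X) → X → X
iter zero    f x = x
iter (suc k) f x = f (iter k f x)

-- conn A u v : u and v lie in the same connected component of (Fin n , A)
-- (reachability in at most n steps, which suffices on n vertices).
conn : ∀ {n} → List (Fin n × Fin n) → Fin n → Fin n → Bool
conn {n} A u = iter n (step A) (u ==_)

reps : ∀ {n} → List (Fin n × Fin n) → List (Fin n)
reps {n} A = filter (λ v → not (any (λ u → does (u <? v) ∧ conn A u v) (allFin n)) Data.Bool.≟ true) (allFin n)

members : ∀ {n} → List (Fin n × Fin n) → Fin n → List (Fin n)
members {n} A r = filter (λ v → conn A r v Data.Bool.≟ true) (allFin n)

Mark : Set
Mark = ℕ × ℕ

_∔_ : Mark → Mark → Mark
(w , d) ∔ (w' , d') = (w + w' , d + d' + 1)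

-- dot-sum of a nonempty list of marks (the empty case never occurs below)
dotSum : List Mark → Mark
dotSum []       = (0 , 0)
dotSum (x ∷ xs) = foldl _∔_ x xs

-- A monomial in the commuting indeterminates z_(w,d) is a finite multiset of
-- marks (list up to permutation); a polynomial with coefficients in ℕ
-- is a finite multiset of monomials.
Monomial : Set
Monomial = List Mark

Poly : Set
Poly = List Monomial

_≈P_ : Poly → Poly → Set
P ≈P Q = Permutation _↭_ P Q

-- M_(T, m)(z) = Σ_{A ⊆ E(T)} Π_C z_{m(C)}
M : ∀ {n} → SimpleGraph n → (Fin n → Mark) → Poly
M G m = map (λ A → map (λ r → dotSum (map m (members A r))) (reps A)) (subsets (edges G))

mω : ∀ {n} → (Fin n → ℕ) → Fin n → Mark
mω ω v = (ω v , 0)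

-- 2-stars: two disjoint stars K_{1,a}, K_{1,b} (a, b ≥ 1) whose centers
-- c₁ , c₂ are joined by an edge.

IsTwoStar : ∀ {n} → SimpleGraph n → Set
IsTwoStar {n} G =
  Σ (Fin n) λ c₁ → Σ (Fin n) λ c₂ →
    (c₁ ≢ c₂)
  × (adj G c₁ c₂ ≡ true)
  × (∀ v → v ≢ c₁ → v ≢ c₂ → ((adj G c₁ v ≡ true) × (adj G c₂ v ≡ false))
                             ⊎ ((adj G c₁ v ≡ false) × (adj G c₂ v ≡ true)))
  × (∀ u v → u ≢ c₁ → u ≢ c₂ → v ≢ c₁ → v ≢ c₂ → adj G u v ≡ false)
  × (Σ (Fin n) λ v → v ≢ c₂ × adj G c₁ v ≡ true)
  × (Σ (Fin n) λ v → v ≢ c₁ × adj G c₂ v ≡ true)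

IsWeight : ∀ {n} → (Fin n → ℕ) → Set
IsWeight ω = ∀ v → 1 ≤ ω v

ωIso : ∀ {n n'} → SimpleGraph n → (Fin n → ℕ) → SimpleGraph n' → (Fin n' → ℕ) → Set
ωIso {n} {n'} G ω G' ω' =
  Σ (Fin n ↔ Fin n') λ f →
    (∀ u v → adj G u v ≡ adj G' (Inverse.to f u) (Inverse.to f v))
  × (∀ v → ω v ≡ ω' (Inverse.to f v))

{-# OPTIONS --safe #-}

-- Let X and Y be the marks of the two stars of a 2-star, that is, of the components left by the
-- removal of the central edge.  Monomials with two factors yield {X , Y} and the multiset L of leaf
-- weights; each centre weight is then determined by the leaves of its star, so the question is how
-- L splits into L₁ and L₂.
--
-- * If X ≠ Y and the second star has at least two leaves, monomials with three factors, exactly one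
--   of them a single vertex and none of them Y, arise only by cutting off a leaf of the second star:
--   they yield L₂.
-- * If X = Y and there are at least two leaves on each side, monomials with four factors, exactly two
--   of them single vertices and none of them X, yield the unordered pairs of a leaf of L₁ and a leaf
--   of L₂.  So f₁ + f₂ and the symmetric product of f₁ and f₂ are known for the multiplicity
--   functions f₁, f₂ of L₁, L₂, and f₁, f₂ are the roots of a quadratic equation over a domain.
-- * If there is one leaf on each side, the multiset of all weights determines those of the centres.
module Submission where

open import Defs
open import Data.Nat using (ℕ)
open import Data.Fin using (Fin)

open import Algebra.Bundles using (CommutativeMonoid)
import Algebra.Properties.CommutativeSemigroup as CommutativeSemigroup
open import Data.Bool as Bool using (Bool; true; false; _∧_; _∨_; not; if_then_else_; T)
open import Data.Bool.ListAction using (any)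
open import Data.Bool.Properties using (T-∨; T-∧; T-≡; T-not-≡; ∨-assoc; ∨-comm)
open import Data.Empty using (⊥; ⊥-elim)
import Data.Fin as Fin
import Data.Fin.Properties as Fin
open import Data.Fin.Permutation using (cast-id; _∘ₚ_)
open import Data.List
  using (List; []; _∷_; [_]; map; _++_; length; filter; foldl; concatMap; allFin; lookup; tabulate)
open import Data.List.Membership.Propositional using (_∈_; _∉_; find; lose)
open import Data.List.Membership.Propositional.Properties
  using (∈-∃++; ∈-++⁺ˡ; ∈-++⁺ʳ; ∈-++⁻; ∈-map⁺; ∈-map⁻; ∈-filter⁺; ∈-filter⁻; ∈-allFin; ∈-length;
         ∈-concatMap⁺; ∈-concatMap⁻)
open import Data.List.Membership.Propositional.Properties.WithK using (unique∧set⇒bag)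
open import Data.List.Properties as List
  using (map-∘; map-++; map-cong; length-map; length-++; length-tabulate; map-tabulate;
         lookup-tabulate; filter-≐)
open import Data.List.Relation.Binary.BagAndSetEquality using (∼bag⇒↭)
import Data.List.Relation.Binary.Permutation.Homogeneous as Homogeneous
open import Data.List.Relation.Binary.Permutation.Propositional
open import Data.List.Relation.Binary.Permutation.Propositional.Properties
  using (↭-length; ∈-resp-↭; drop-∷; shift; map⁺; ++⁺; ++-commutativeMonoid)
import Data.List.Relation.Binary.Permutation.Setoid.Properties as Permutationₛ
open import Data.List.Relation.Binary.Pointwise using ([]; _∷_; Pointwise)
open import Data.List.Relation.Unary.All as All using ([]; _∷_)
import Data.List.Relation.Unary.All.Properties as All
open import Data.List.Relation.Unary.AllPairs as AllPairs using ([]; _∷_)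
import Data.List.Relation.Unary.AllPairs.Properties as AllPairs
open import Data.List.Relation.Unary.Any using (here; there; any?)
open import Data.List.Relation.Unary.Any.Properties using (any⁺; any⁻)
open import Data.List.Relation.Unary.Unique.Propositional using (Unique)
import Data.List.Relation.Unary.Unique.Propositional.Properties as Unique
open import Data.Nat using (zero; suc; _+_; _*_; _∸_; _≡ᵇ_; _≤_; _<_; z≤n; s≤s)
open import Data.Nat.ListAction using (sum)
open import Data.Nat.ListAction.Properties using (sum-↭; sum-++)
import Data.Nat.Properties as ℕ
open import Data.Nat.Properties
  using (+-assoc; +-cancelʳ-≡; +-cancelˡ-≡; +-comm; +-identityʳ; +-mono-≤; +-suc; 1+n≢n;
         *-cancelʳ-≡; *-comm; *-distribˡ-+; *-zeroʳ; <-asym; <-cmp; <⇒≱; _≤?_; m+n≡0⇒n≡0;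
         m+n∸n≡m; m≤n+m; m≤n⇒∃[o]m+o≡n; suc-injective)
open import Data.Nat.Tactic.RingSolver using (solve-∀)
open import Data.Product as Product using (_×_; _,_; proj₁; proj₂; Σ; ∃)
open import Data.Product.Properties using (≡-dec)
open import Data.Sum as Sum using (_⊎_; inj₁; inj₂; [_,_]′)
open import Function using (_∘_)
open import Function.Bundles using (Equivalence; Inverse; mk⇔; _↔_)
open import Relation.Binary.Definitions using (DecidableEquality; tri<; tri≈; tri>)
open import Relation.Binary.PropositionalEquality
  using (_≡_; _≢_; refl; cong; cong₂; subst; subst₂; setoid; module ≡-Reasoning)
  renaming (sym to ≡-sym; trans to ≡-trans)
open import Relation.Nullary using (¬_; Dec; yes; no; does; ¬?; _×-dec_)
open import Relation.Nullary.Decidable using (dec-true; dec-false)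
open Equivalence using (to; from)
open CommutativeSemigroup ℕ.+-commutativeSemigroup
  using () renaming (interchange to +-interchange; x∙yz≈y∙xz to +-x∙yz≈y∙xz)

-- Indicators and multiplicities in lists.

indicator : {P : Set} → Dec P → ℕ
indicator (yes _) = 1
indicator (no _)  = 0

indicator-no : {P : Set} (d : Dec P) → ¬ P → indicator d ≡ 0
indicator-no (yes p) ¬p = ⊥-elim (¬p p)
indicator-no (no _)  _  = refl

indicator-yes : {P : Set} (d : Dec P) → P → indicator d ≡ 1
indicator-yes (yes _) _ = refl
indicator-yes (no ¬p) p = ⊥-elim (¬p p)

indicator-cong : {P Q : Set} (p? : Dec P) (q? : Dec Q) → (P → Q) → (Q → P) →
                 indicator p? ≡ indicator q?
indicator-cong (yes p) q? f g = ≡-sym (indicator-yes q? (f p))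
indicator-cong (no ¬p) q? f g = ≡-sym (indicator-no q? (¬p ∘ g))

module Count {X : Set} (_≟_ : DecidableEquality X) where

  count : X → List X → ℕ
  count x ys = sum (map (λ y → indicator (y ≟ x)) ys)

  count-++ : ∀ x ys zs → count x (ys ++ zs) ≡ count x ys + count x zs
  count-++ x ys zs =
    ≡-trans (cong sum (map-++ _ ys zs)) (sum-++ (map (λ y → indicator (y ≟ x)) ys) _)

  count-↭ : ∀ x {ys zs} → ys ↭ zs → count x ys ≡ count x zs
  count-↭ x p = sum-↭ (map⁺ _ p)

  count-∈ : ∀ {x ys} → x ∈ ys → count x ys ≢ 0
  count-∈ {x}          (here refl) rewrite indicator-yes (x ≟ x) refl = λ ()
  count-∈ {x} {y ∷ ys} (there x∈)  = count-∈ x∈ ∘ m+n≡0⇒n≡0 (indicator (y ≟ x))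

  count-∉ : ∀ x ys → x ∉ ys → count x ys ≡ 0
  count-∉ x []       x∉ = refl
  count-∉ x (y ∷ ys) x∉
    rewrite indicator-no (y ≟ x) (λ { refl → x∉ (here refl) }) = count-∉ x ys (x∉ ∘ there)

  -- The head of `xs` is searched for in `ys` and removed from both, which lowers both counts alike,
  -- so a difference found later persists. The explicit witness is what the case of equal marks
  -- starts from.
  ↭-or-count-differs : ∀ xs ys → xs ↭ ys ⊎ ∃ λ x → count x xs ≢ count x ys
  ↭-or-count-differs []       []       = inj₁ refl
  ↭-or-count-differs []       (y ∷ ys) = inj₂ (y , count-∈ {ys = y ∷ ys} (here refl) ∘ ≡-sym)
  ↭-or-count-differs (x ∷ xs) ys with any? (x ≟_) ys
  ... | no x∉ = inj₂ (x , λ e → count-∈ {ys = x ∷ xs} (here refl) (≡-trans e (count-∉ x ys x∉)))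
  ... | yes x∈ with ∈-∃++ x∈
  ...   | us , vs , refl with ↭-or-count-differs xs (us ++ vs)
  ...     | inj₁ p       = inj₁ (↭-trans (prep x p) (↭-sym (shift x us vs)))
  ...     | inj₂ (y , q) = inj₂ (y , λ e → q (+-cancelˡ-≡ _ _ _
                             (≡-trans e (count-↭ y (shift x us vs)))))

  count-ext : ∀ xs ys → (∀ x → count x xs ≡ count x ys) → xs ↭ ys
  count-ext xs ys h with ↭-or-count-differs xs ys
  ... | inj₁ p       = p
  ... | inj₂ (x , q) = ⊥-elim (q (h x))

↭-pair : {X : Set} {a b c d : X} → a ∷ b ∷ [] ↭ c ∷ d ∷ [] →
         (a ≡ c × b ≡ d) ⊎ (a ≡ d × b ≡ c)
↭-pair p with ∈-resp-↭ p (here refl)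
... | here refl with ∈-resp-↭ (drop-∷ p) (here refl)
...   | here refl = inj₁ (refl , refl)
↭-pair p | there (here refl) with ∈-resp-↭ (drop-∷ (↭-trans p (swap _ _ refl))) (here refl)
...   | here refl = inj₂ (refl , refl)

-- Sums over sublists

-- The recursion is that of `subsets`, so a sum over edge sets unfolds one edge at a time.
Σ⊆ : {X : Set} → List X → (List X → ℕ) → ℕ
Σ⊆ []       g = g []
Σ⊆ (x ∷ xs) g = Σ⊆ xs g + Σ⊆ xs (g ∘ (x ∷_))

Σ⊆-cong : {X : Set} (xs : List X) {g h : List X → ℕ} → (∀ t → g t ≡ h t) → Σ⊆ xs g ≡ Σ⊆ xs h
Σ⊆-cong []       e = e []
Σ⊆-cong (x ∷ xs) e = cong₂ _+_ (Σ⊆-cong xs e) (Σ⊆-cong xs (e ∘ (x ∷_)))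

Σ⊆-zero : {X : Set} (xs : List X) {g : List X → ℕ} → (∀ t → g t ≡ 0) → Σ⊆ xs g ≡ 0
Σ⊆-zero []       e = e []
Σ⊆-zero (x ∷ xs) e = cong₂ _+_ (Σ⊆-zero xs e) (Σ⊆-zero xs (e ∘ (x ∷_)))

Σ⊆-[] : {X : Set} (xs : List X) {g : List X → ℕ} → (∀ x t → g (x ∷ t) ≡ 0) → Σ⊆ xs g ≡ g []
Σ⊆-[] []       e = refl
Σ⊆-[] (x ∷ xs) e =
  ≡-trans (cong₂ _+_ (Σ⊆-[] xs e) (Σ⊆-zero xs (e x))) (+-identityʳ _)

-- Prescribing the number of factors of a monomial bounds the number of leaves cut off; this
-- collapses the sums in `value` to one leaf per star.
Σ⊆-singletons : {X : Set} (xs : List X) {g : List X → ℕ} → g [] ≡ 0 →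
  (∀ x y t → g (x ∷ y ∷ t) ≡ 0) → Σ⊆ xs g ≡ sum (map (g ∘ [_]) xs)
Σ⊆-singletons []       e₀ e = e₀
Σ⊆-singletons (x ∷ xs) {g} e₀ e =
  ≡-trans (cong₂ _+_ (Σ⊆-singletons xs e₀ e) (Σ⊆-[] xs (e x)))
          (+-comm (sum (map (g ∘ [_]) xs)) (g [ x ]))

sum-cong : {X : Set} {g h : X → ℕ} → (∀ x → g x ≡ h x) → ∀ xs → sum (map g xs) ≡ sum (map h xs)
sum-cong e xs = cong sum (map-cong e xs)

-- Functions of monomials and their sums over a 2-star.

_≟ᵐ_ : DecidableEquality Mark
_≟ᵐ_ = ≡-dec ℕ._≟_ ℕ._≟_

open Count ℕ._≟_ public
module Marks = Count _≟ᵐ_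

atoms : List ℕ → Monomial
atoms = map (_, 0)

-- What is left of a component of mark `(x , d)` once leaves of weights `t` are cut off: `d` is one
-- less than its number of vertices, so each leaf takes away 1.
remove : Mark → List ℕ → Mark
remove (x , d) t = x ∸ sum t , d ∸ length t

isZero : ℕ → ℕ
isZero zero    = 1
isZero (suc _) = 0

-- A mark (w , 0) belongs to a component with a single vertex.
isolated : Monomial → ℕ
isolated m = sum (map (isZero ∘ proj₂) m)

-- The sum of φ over the monomials of a 2-star whose two stars have total marks
-- X and Y and leaf weights L₁ and L₂: t (resp. t₁ and t₂) lists the leaves cut
-- off, and the two summands are the edge sets with and without the central edge.
value : (Monomial → ℕ) → Mark → Mark → List ℕ → List ℕ → ℕ
value φ X Y L₁ L₂ =
    Σ⊆ (L₁ ++ L₂) (λ t → φ (remove (X ∔ Y) t ∷ atoms t))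
  + Σ⊆ L₁ (λ t₁ → Σ⊆ L₂ (λ t₂ → φ (remove X t₁ ∷ remove Y t₂ ∷ atoms (t₁ ++ t₂))))

-- Monomials are lists up to permutation, so sums of such functions depend on the polynomial alone.
Invariant : (Monomial → ℕ) → Set
Invariant φ = ∀ {m m'} → m ↭ m' → φ m ≡ φ m'

isolated-invariant : Invariant isolated
isolated-invariant p = sum-↭ (map⁺ _ p)

-- The tests are Boolean, so they compute on lists of known shape and most vanishing terms are
-- closed by `refl`.
select : ℕ → ℕ → (Monomial → ℕ) → Monomial → ℕ
select n k φ m = if (length m ≡ᵇ n) ∧ (isolated m ≡ᵇ k) then φ m else 0

select-invariant : ∀ n k {φ} → Invariant φ → Invariant (select n k φ)
select-invariant n k inv p
  rewrite ↭-length p | isolated-invariant p | inv p = refl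

-- A star that loses its central edge but no leaf contributes its own mark as a factor; this
-- discards the monomials with such a factor.
avoid : Mark → (Monomial → ℕ) → Monomial → ℕ
avoid X φ m = if Marks.count X m ≡ᵇ 0 then φ m else 0

avoid-invariant : ∀ X {φ} → Invariant φ → Invariant (avoid X φ)
avoid-invariant X inv p rewrite Marks.count-↭ X p | inv p = refl

#_ : ℕ → Monomial → ℕ
(# w) m = Marks.count (w , 0) m

#-invariant : ∀ w → Invariant (# w)
#-invariant w p = Marks.count-↭ (w , 0) p

indicator-atom : ∀ l w → indicator ((l , 0) ≟ᵐ (w , 0)) ≡ indicator (l ℕ.≟ w)
indicator-atom l w = indicator-cong _ _ (cong proj₁) (cong (_, 0))

indicator-positive : ∀ x d w → indicator ((x , suc d) ≟ᵐ (w , 0)) ≡ 0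
indicator-positive x d w = indicator-no ((x , suc d) ≟ᵐ (w , 0)) λ ()

select-isolated : ∀ n k φ m → (isolated m ≡ᵇ k) ≡ false → select n k φ m ≡ 0
select-isolated n k φ m e rewrite e with length m ≡ᵇ n
... | true  = refl
... | false = refl

select-zero : ∀ n k φ m → φ m ≡ 0 → select n k φ m ≡ 0
select-zero n k φ m e rewrite e with (length m ≡ᵇ n) ∧ (isolated m ≡ᵇ k)
... | true  = refl
... | false = refl

avoid-∈ : ∀ {X} φ m → X ∈ m → avoid X φ m ≡ 0
avoid-∈ {X} φ m X∈m with Marks.count X m in e
... | zero  = ⊥-elim (Marks.count-∈ X∈m e)
... | suc _ = refl

avoid-∉ : ∀ {X} φ m → X ∉ m → avoid X φ m ≡ φ m
avoid-∉ {X} φ m X∉m rewrite Marks.count-∉ X m X∉m = refl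

-- Excludes edge sets with the central edge: `suc n` leaves cut off are already more than `n` single
-- vertices, whatever the main component contributes.
m+1+n≢ᵇn : ∀ m n → (m + suc n ≡ᵇ n) ≡ false
m+1+n≢ᵇn m n rewrite +-suc m n = go m n
  where
  go : ∀ m n → (suc (m + n) ≡ᵇ n) ≡ false
  go m zero    = refl
  go m (suc n) rewrite +-suc m n = go m n

#-atoms : ∀ w t → (# w) (atoms t) ≡ count w t
#-atoms w []      = refl
#-atoms w (l ∷ t) = cong₂ _+_ (indicator-atom l w) (#-atoms w t)

-- Edge sets missing a single leaf edge have two components, one of them a single vertex.
leaf-count : ∀ w {X Y} → 1 ≤ proj₂ X → 1 ≤ proj₂ Y → ∀ L₁ L₂ →
  value (select 2 1 (# w)) X Y L₁ L₂ ≡ count w (L₁ ++ L₂)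
leaf-count w {x , suc a} {y , suc b} (s≤s _) (s≤s _) L₁ L₂ = ≡-trans (cong₂ _+_
    (≡-trans (Σ⊆-singletons (L₁ ++ L₂) refl (λ _ _ _ → refl)) (sum-cong cut-leaf (L₁ ++ L₂)))
    (Σ⊆-zero L₁ λ t₁ → Σ⊆-zero L₂ λ t₂ → no-leaf t₁ t₂))
  (+-identityʳ _)
  where
  cut-leaf : ∀ l → select 2 1 (# w) (remove ((x , suc a) ∔ (y , suc b)) (l ∷ []) ∷ atoms (l ∷ []))
                 ≡ indicator (l ℕ.≟ w)
  -- Moving the 1 to the front exposes a `suc`, so `isZero` sees that the main component is not a
  -- single vertex.
  cut-leaf l rewrite +-comm (a + suc b) 1
    | indicator-positive (x + y ∸ (l + 0)) (a + suc b) w | indicator-atom l w = +-identityʳ _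
  no-leaf : ∀ t₁ t₂ → select 2 1 (# w) (remove (x , suc a) t₁ ∷ remove (y , suc b) t₂ ∷ atoms (t₁ ++ t₂)) ≡ 0
  no-leaf []      []      = refl
  no-leaf []      (_ ∷ _) = refl
  no-leaf (_ ∷ _) _       = refl

-- The removal of the central edge leaves two components, neither a single vertex.
star-mark-count : ∀ Z {X Y} → 1 ≤ proj₂ X → 1 ≤ proj₂ Y → ∀ L₁ L₂ →
  value (select 2 0 (Marks.count Z)) X Y L₁ L₂ ≡ Marks.count Z (X ∷ Y ∷ [])
star-mark-count Z {x , suc a} {y , suc b} (s≤s _) (s≤s _) L₁ L₂ = cong₂ _+_
  (Σ⊆-zero (L₁ ++ L₂) central)
  (≡-trans (Σ⊆-[] L₁ (λ l t₁ → Σ⊆-zero L₂ (λ t₂ → refl))) (Σ⊆-[] L₂ (λ l t₂ → refl)))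
  where
  central : ∀ t → select 2 0 (Marks.count Z) (remove ((x , suc a) ∔ (y , suc b)) t ∷ atoms t) ≡ 0
  central []          = refl
  central (l ∷ [])    = select-isolated 2 0 (Marks.count Z) (remove ((x , suc a) ∔ (y , suc b)) (l ∷ []) ∷ atoms (l ∷ []))
                          (m+1+n≢ᵇn (isZero (a + suc b + 1)) 0)
  central (_ ∷ _ ∷ _) = refl

-- As 2 ≤ proj₂ Y, the leaf cut off from the second star is the only single-vertex component.
second-star-leaf-count : ∀ w {X Y} → 1 ≤ proj₂ X → 2 ≤ proj₂ Y → X ≢ Y → ∀ L₁ L₂ →
  value (select 3 1 (avoid Y (# w))) X Y L₁ L₂ ≡ count w L₂
second-star-leaf-count w {x , suc a} {y , suc (suc b)} (s≤s _) (s≤s (s≤s _)) X≢Y L₁ L₂ = cong₂ _+_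
  (Σ⊆-zero (L₁ ++ L₂) central)
  (≡-trans (Σ⊆-[] L₁ (λ l t₁ → Σ⊆-zero L₂ (cut-first l t₁)))
  (≡-trans (Σ⊆-singletons L₂ refl (λ _ _ _ → refl)) (sum-cong cut-second L₂)))
  where
  X = (x , suc a)
  Y = (y , suc (suc b))
  φ = select 3 1 (avoid Y (# w))
  central : ∀ t → φ (remove (X ∔ Y) t ∷ atoms t) ≡ 0
  central []              = refl
  central (_ ∷ [])        = refl
  -- Three factors with the central edge kept require two cut leaves, hence at least two single
  -- vertices.
  central t@(_ ∷ _ ∷ [])  = select-isolated 3 1 (avoid Y (# w)) (remove (X ∔ Y) t ∷ atoms t)
                              (m+1+n≢ᵇn (isZero (proj₂ (remove (X ∔ Y) t))) 1)
  central (_ ∷ _ ∷ _ ∷ _) = refl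
  cut-first : ∀ l t₁ t₂ → φ (remove X (l ∷ t₁) ∷ remove Y t₂ ∷ atoms (l ∷ t₁ ++ t₂)) ≡ 0
  -- The leaf is cut from the first star, so the second is whole and `Y` is a factor.
  cut-first l []      []      = select-zero 3 1 (avoid Y (# w)) m (avoid-∈ (# w) m (there (here refl)))
    where m = remove X (l ∷ []) ∷ Y ∷ atoms (l ∷ [])
  cut-first l []      (_ ∷ _) = refl
  cut-first l (_ ∷ _) t₂      = refl
  cut-second : ∀ l → φ (X ∷ remove Y (l ∷ []) ∷ atoms (l ∷ [])) ≡ indicator (l ℕ.≟ w)
  -- `Y` is not a factor here: it differs from `X`, the rest of the second star has a smaller second
  -- coordinate, and that of a single vertex is 0.
  cut-second l = ≡-trans (avoid-∉ (# w) (X ∷ remove Y (l ∷ []) ∷ atoms (l ∷ [])) λ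
      { (here e)                 → X≢Y (≡-sym e)
      ; (there (here e))         → 1+n≢n (cong proj₂ e)
      ; (there (there (here ()))) })
    (≡-trans (cong₂ _+_ (indicator-positive x a w)
               (cong₂ _+_ (indicator-positive (y ∸ (l + 0)) b w)
                 (cong (_+ 0) (indicator-atom l w))))
             (+-identityʳ _))

δ : ℕ → ℕ → ℕ
δ w l = indicator (l ℕ.≟ w)

-- As 2 ≤ proj₂ X, the two leaves cut off are the only single-vertex components.
leaf-pair-count : ∀ w w' {X} → 2 ≤ proj₂ X → ∀ L₁ L₂ →
  value (select 4 2 (avoid X (λ m → (# w) m * (# w') m))) X X L₁ L₂
    ≡ sum (map (λ l₁ → sum (map (λ l₂ →
        (δ w l₁ + δ w l₂) * (δ w' l₁ + δ w' l₂)) L₂)) L₁)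
leaf-pair-count w w' {x , suc (suc a)} (s≤s (s≤s _)) L₁ L₂ = cong₂ _+_
  (Σ⊆-zero (L₁ ++ L₂) central)
  (≡-trans (Σ⊆-singletons L₁ (Σ⊆-zero L₂ uncut-first) (λ l l' t₁ → Σ⊆-zero L₂ (cut-two l l' t₁)))
    (sum-cong (λ l₁ → ≡-trans (Σ⊆-singletons L₂ (uncut-second (l₁ ∷ [])) (λ _ _ _ → refl))
                              (sum-cong (cut-both l₁) L₂)) L₁))
  where
  X = (x , suc (suc a))
  ψ φ : Monomial → ℕ
  ψ m = (# w) m * (# w') m
  φ = select 4 2 (avoid X ψ)
  central : ∀ t → φ (remove (X ∔ X) t ∷ atoms t) ≡ 0
  central []                  = refl
  central (_ ∷ [])            = refl
  central (_ ∷ _ ∷ [])        = refl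
  central t@(_ ∷ _ ∷ _ ∷ [])  = select-isolated 4 2 (avoid X ψ) (remove (X ∔ X) t ∷ atoms t)
                                  (m+1+n≢ᵇn (isZero (proj₂ (remove (X ∔ X) t))) 2)
  central (_ ∷ _ ∷ _ ∷ _ ∷ _) = refl
  uncut-first : ∀ t₂ → φ (X ∷ remove X t₂ ∷ atoms t₂) ≡ 0
  uncut-first t₂ = select-zero 4 2 (avoid X ψ) m (avoid-∈ ψ m (here refl))
    where m = X ∷ remove X t₂ ∷ atoms t₂
  uncut-second : ∀ t₁ → φ (remove X t₁ ∷ X ∷ atoms (t₁ ++ [])) ≡ 0
  uncut-second t₁ = select-zero 4 2 (avoid X ψ) m (avoid-∈ ψ m (there (here refl)))
    where m = remove X t₁ ∷ X ∷ atoms (t₁ ++ [])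
  cut-two : ∀ l l' t₁ t₂ →
    φ (remove X (l ∷ l' ∷ t₁) ∷ remove X t₂ ∷ atoms (l ∷ l' ∷ t₁ ++ t₂)) ≡ 0
  -- With all cuts made in the first star, the second one is whole, and its mark is `X` too.
  cut-two l l' t₁      []      = uncut-second (l ∷ l' ∷ t₁)
  cut-two l l' []      (_ ∷ _) = refl
  cut-two l l' (_ ∷ _) (_ ∷ _) = refl
  #-cut : ∀ u l₁ l₂ → (# u) (remove X (l₁ ∷ []) ∷ remove X (l₂ ∷ []) ∷ atoms (l₁ ∷ l₂ ∷ []))
                    ≡ δ u l₁ + δ u l₂
  #-cut u l₁ l₂ = cong₂ _+_ (indicator-positive (x ∸ (l₁ + 0)) a u)
    (cong₂ _+_ (indicator-positive (x ∸ (l₂ + 0)) a u)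
      (cong₂ _+_ (indicator-atom l₁ u)
        (≡-trans (+-identityʳ _) (indicator-atom l₂ u))))
  cut-both : ∀ l₁ l₂ → φ (remove X (l₁ ∷ []) ∷ remove X (l₂ ∷ []) ∷ atoms (l₁ ∷ l₂ ∷ []))
                     ≡ (δ w l₁ + δ w l₂) * (δ w' l₁ + δ w' l₂)
  cut-both l₁ l₂ = ≡-trans
    (avoid-∉ ψ (remove X (l₁ ∷ []) ∷ remove X (l₂ ∷ []) ∷ atoms (l₁ ∷ l₂ ∷ [])) λ
      { (here e)         → 1+n≢n (cong proj₂ e)
      ; (there (here e)) → 1+n≢n (cong proj₂ e)
      ; (there (there (here ())))
      ; (there (there (there (here ())))) })
    (cong₂ _*_ (#-cut w l₁ l₂) (#-cut w' l₁ l₂))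

-- A path on four vertices falls into four components only if all edges are removed; what remains of
-- each star is then its bare centre.
path-weight-count : ∀ w α l β m →
  value (select 4 4 (# w)) (α + (l + 0) , 1) (β + (m + 0) , 1) (l ∷ []) (m ∷ [])
    ≡ count w (α ∷ β ∷ l ∷ m ∷ [])
path-weight-count w α l β m
  rewrite m+n∸n≡m α (l + 0) | m+n∸n≡m β (m + 0) = #-atoms w (α ∷ β ∷ l ∷ m ∷ [])

-- Products of multiplicities from sums over pairs of leaves.

both : ℕ → ℕ → List ℕ → ℕ
both w w' L = sum (map (λ l → δ w l * δ w' l) L)

row-sum-expand : ∀ w w' p q L →
  sum (map (λ l → (p + δ w l) * (q + δ w' l)) L)
    ≡ length L * (p * q) + (p * count w' L + q * count w L) + both w w' L
row-sum-expand w w' p q []      rewrite *-zeroʳ p | *-zeroʳ q = refl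
row-sum-expand w w' p q (k ∷ L) rewrite row-sum-expand w w' p q L =
  arith p q (δ w k) (δ w' k) (length L) (count w L) (count w' L) (both w w' L)
  where
  arith : ∀ p q r s n c d b →
    (p + r) * (q + s) + (n * (p * q) + (p * d + q * c) + b)
      ≡ (p * q + n * (p * q)) + (p * (s + d) + q * (r + c)) + (r * s + b)
  arith = solve-∀

-- Multiplied out, a product of two indicators of the same leaf recurs for every partner in the
-- other star, and products across the stars factor into counts. For lists of equal length the first
-- bracket depends only on their union, which isolates the second.
pair-sum-expand : ∀ w w' L₁ L₂ →
  sum (map (λ l₁ → sum (map (λ l₂ → (δ w l₁ + δ w l₂) * (δ w' l₁ + δ w' l₂)) L₂)) L₁)
    ≡ (length L₂ * both w w' L₁ + length L₁ * both w w' L₂)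
      + (count w L₁ * count w' L₂ + count w' L₁ * count w L₂)
pair-sum-expand w w' []       L₂ rewrite *-zeroʳ (length L₂) = refl
pair-sum-expand w w' (l ∷ L₁) L₂
  rewrite row-sum-expand w w' (δ w l) (δ w' l) L₂ | pair-sum-expand w w' L₁ L₂ =
  arith (length L₂) (δ w l) (δ w' l) (count w L₂) (count w' L₂) (both w w' L₂)
        (both w w' L₁) (length L₁) (count w L₁) (count w' L₁)
  where
  arith : ∀ n p q c d b b' n' c' d' →
    (n * (p * q) + (p * d + q * c) + b) + ((n * b' + n' * b) + (c' * d + d' * c))
      ≡ (n * (p * q + b') + (b + n' * b)) + ((p + c') * d + (q + d') * c)
  arith = solve-∀

-- Pairs of natural numbers with equal sums and equal products.

-- Both pairs are the roots of one quadratic. Without subtraction: if `c` is `suc a + k`, the sums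
-- give `b` as `suc k + d`, and the doubled products reduce to `a * (suc k + suc k) ≡ d * (suc k +
-- suc k)`.
equal-sum-product-< : ∀ {a b c d} → a < c → a + b ≡ c + d → a * b + b * a ≡ c * d + d * c → a ≡ d
equal-sum-product-< {a} {b} {c} {d} a<c s p with m≤n⇒∃[o]m+o≡n a<c
... | k , refl with +-cancelˡ-≡ a b (suc k + d) (≡-trans s (rearrange a k d))
  where
  rearrange : ∀ a k d → suc a + k + d ≡ a + (suc k + d)
  rearrange = solve-∀
... | refl = *-cancelʳ-≡ a d (suc k + suc k) (+-cancelˡ-≡ (a * d + a * d) _ _
    (≡-trans (left a k d) (≡-trans p (right a k d))))
  where
  left : ∀ a k d → a * d + a * d + a * (suc k + suc k) ≡ a * (suc k + d) + (suc k + d) * a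
  left = solve-∀
  right : ∀ a k d → (suc a + k) * d + d * (suc a + k) ≡ a * d + a * d + d * (suc k + suc k)
  right = solve-∀

equal-sum-product : ∀ {a b c d} → a ≢ c → a + b ≡ c + d → a * b + b * a ≡ c * d + d * c → a ≡ d
equal-sum-product {a} {b} {c} {d} a≢c s p with <-cmp a c
... | tri< a<c _ _ = equal-sum-product-< a<c s p
... | tri≈ _ a≡c _ = ⊥-elim (a≢c a≡c)
... | tri> _ _ c<a with equal-sum-product-< c<a (≡-sym s) (≡-sym p)
...   | refl = +-cancelʳ-≡ b a d (≡-trans s (+-comm b d))

-- Subtracting `p` times the first equation from the second leaves `a * (q - p) = d * (q - p)`. This
-- carries an exchange found at one weight over to every other weight.
cross-cancel-< : ∀ {a b c d p q} → p < q → a + b ≡ c + d → a * q + p * b ≡ c * p + q * d → a ≡ d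
cross-cancel-< {a} {b} {c} {d} {p} p<q s e with m≤n⇒∃[o]m+o≡n p<q
... | k , refl = *-cancelʳ-≡ a d (suc k) (+-cancelˡ-≡ (p * (a + b)) _ _
    (≡-trans (left a b p k) (≡-trans e (≡-trans (right c d p k) (cong (λ x → p * x + d * suc k) (≡-sym s))))))
  where
  left : ∀ a b p k → p * (a + b) + a * suc k ≡ a * (suc p + k) + p * b
  left = solve-∀
  right : ∀ c d p k → c * p + (suc p + k) * d ≡ p * (c + d) + d * suc k
  right = solve-∀

cross-cancel : ∀ {a b c d p q} → p ≢ q → a + b ≡ c + d → a * q + p * b ≡ c * p + q * d → a ≡ d
cross-cancel {a} {b} {c} {d} {p} {q} p≢q s e with <-cmp p q
... | tri< p<q _ _ = cross-cancel-< p<q s e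
... | tri≈ _ p≡q _ = ⊥-elim (p≢q p≡q)
... | tri> _ _ q<p with cross-cancel-< {b} {a} {d} {c} q<p
        (≡-trans (+-comm b a) (≡-trans s (+-comm c d)))
        (≡-trans (flip b a p q) (≡-trans e (flip′ c d p q)))
  where
  flip : ∀ b a p q → b * p + q * a ≡ a * q + p * b
  flip = solve-∀
  flip′ : ∀ c d p q → c * p + q * d ≡ d * q + p * c
  flip′ = solve-∀
... | refl = +-cancelʳ-≡ b a d (≡-trans s (+-comm b d))

-- Reconstruction of two stars from sums of invariant functions.

record Star : Set where
  constructor star
  field
    centre : ℕ
    leaves : List ℕ
open Star

mark : Star → Mark
mark S = centre S + sum (leaves S) , length (leaves S)

_≅_ : Star → Star → Set
S ≅ S' = centre S ≡ centre S' × leaves S ↭ leaves S'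

-- The first coordinate of the mark is the centre weight plus the leaf weights, so the centre
-- follows by cancellation.
≅-from-leaves : ∀ {S S'} → mark S ≡ mark S' → leaves S ↭ leaves S' → S ≅ S'
≅-from-leaves {S} {S'} e p = +-cancelʳ-≡ (sum (leaves S')) _ _
  (≡-trans (cong (centre S +_) (≡-sym (sum-↭ p))) (cong proj₁ e)) , p

-- `F` stands for summation over the monomials of a polynomial. Two 2-stars with the same polynomial
-- thus become two realisations of a single `F`.
record Realises (F : (Monomial → ℕ) → ℕ) (S₁ S₂ : Star) : Set where
  constructor realises
  field
    value-at : ∀ φ → Invariant φ → F φ ≡ value φ (mark S₁) (mark S₂) (leaves S₁) (leaves S₂)
open Realises

Leafy : Star → Set
Leafy S = 1 ≤ length (leaves S)

module _ {F} {S₁ S₂ S₁' S₂' : Star}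
         (real : Realises F S₁ S₂) (real' : Realises F S₁' S₂')
         (p₁ : Leafy S₁) (p₂ : Leafy S₂) (p₁' : Leafy S₁') (p₂' : Leafy S₂') where

  private
    L₁  = leaves S₁
    L₂  = leaves S₂
    L₁' = leaves S₁'
    L₂' = leaves S₂'

  compare : ∀ φ → Invariant φ → value φ (mark S₁) (mark S₂) L₁ L₂ ≡ value φ (mark S₁') (mark S₂') L₁' L₂'
  compare φ inv = ≡-trans (≡-sym (value-at real φ inv)) (value-at real' φ inv)

  leaves-↭ : L₁ ++ L₂ ↭ L₁' ++ L₂'
  leaves-↭ = count-ext _ _ λ w →
    ≡-trans (≡-sym (leaf-count w p₁ p₂ L₁ L₂))
    (≡-trans (compare (select 2 1 (# w)) (select-invariant 2 1 {φ = # w} (#-invariant w)))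
             (leaf-count w p₁' p₂' L₁' L₂'))

  leaves-count : ∀ w → count w L₁ + count w L₂ ≡ count w L₁' + count w L₂'
  leaves-count w = ≡-trans (≡-sym (count-++ w L₁ L₂))
                   (≡-trans (count-↭ w leaves-↭) (count-++ w L₁' L₂'))

  marks-agree : (mark S₁ ≡ mark S₁' × mark S₂ ≡ mark S₂') ⊎ (mark S₁ ≡ mark S₂' × mark S₂ ≡ mark S₁')
  marks-agree = ↭-pair (Marks.count-ext _ _ λ Z →
    ≡-trans (≡-sym (star-mark-count Z p₁ p₂ L₁ L₂))
    (≡-trans (compare (select 2 0 (Marks.count Z))
               (select-invariant 2 0 {φ = Marks.count Z} (Marks.count-↭ Z)))
             (star-mark-count Z p₁' p₂' L₁' L₂')))

  -- `L₂` is read off directly, `L₁` is the rest of the union of the leaves, and the marks give the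
  -- centres.
  distinct-marks : mark S₁ ≡ mark S₁' → mark S₂ ≡ mark S₂' → mark S₁ ≢ mark S₂ →
                   2 ≤ length L₂ → S₁ ≅ S₁' × S₂ ≅ S₂'
  distinct-marks e₁ e₂ ne two =
    ≅-from-leaves e₁ (count-ext _ _ λ w → +-cancelʳ-≡ (count w L₂') _ _
      (≡-trans (cong (count w L₁ +_) (≡-sym (L₂-count w))) (leaves-count w))) ,
    ≅-from-leaves e₂ (count-ext _ _ L₂-count)
    where
    L₂-count : ∀ w → count w L₂ ≡ count w L₂'
    L₂-count w = begin
      count w L₂
        ≡⟨ second-star-leaf-count w p₁ two ne L₁ L₂ ⟨
      value φ (mark S₁) (mark S₂) L₁ L₂
        ≡⟨ compare φ (select-invariant 3 1 {φ = avoid (mark S₂) (# w)}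
             (avoid-invariant (mark S₂) {φ = # w} (#-invariant w))) ⟩
      value φ (mark S₁') (mark S₂') L₁' L₂'
        ≡⟨ cong (λ Z → value (select 3 1 (avoid Z (# w))) (mark S₁') (mark S₂') L₁' L₂') e₂ ⟩
      value (select 3 1 (avoid (mark S₂') (# w))) (mark S₁') (mark S₂') L₁' L₂'
        ≡⟨ second-star-leaf-count w p₁' (subst (2 ≤_) (cong proj₂ e₂) two)
             (λ e → ne (≡-trans e₁ (≡-trans e (≡-sym e₂)))) L₁' L₂' ⟩
      count w L₂' ∎
      where
      open ≡-Reasoning
      φ = select 3 1 (avoid (mark S₂) (# w))

  module _ (e₁ : mark S₁ ≡ mark S₁') (e₂ : mark S₂ ≡ mark S₂') (e : mark S₁ ≡ mark S₂)
           (two : 2 ≤ length L₁) where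

    -- Both sides of the leaf pair sum are expanded; the term added here for cancellation depends
    -- only on the common union of the leaves and on the common number of leaves.
    cross-count : ∀ w w' → count w L₁ * count w' L₂ + count w' L₁ * count w L₂
                         ≡ count w L₁' * count w' L₂' + count w' L₁' * count w L₂'
    cross-count w w' = +-cancelˡ-≡ (length L₁ * both w w' (L₁ ++ L₂)) _ _ (begin
      length L₁ * both w w' (L₁ ++ L₂) + cross L₁ L₂
        ≡⟨ expand L₁ L₂ refl (cong proj₂ (≡-sym e)) ⟨
      value φ X X L₁ L₂
        ≡⟨ cong (λ Z → value φ X Z L₁ L₂) e ⟩
      value φ X (mark S₂) L₁ L₂
        ≡⟨ compare φ (select-invariant 4 2 {φ = avoid X ψ} (avoid-invariant X {φ = ψ}
             (λ p → cong₂ _*_ (#-invariant w p) (#-invariant w' p)))) ⟩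
      value φ (mark S₁') (mark S₂') L₁' L₂'
        ≡⟨ cong₂ (λ Z Z' → value φ Z Z' L₁' L₂') e₁ (≡-trans e e₂) ⟨
      value φ X X L₁' L₂'
        ≡⟨ expand L₁' L₂' (cong proj₂ (≡-sym e₁)) (cong proj₂ (≡-sym (≡-trans e e₂))) ⟩
      length L₁ * both w w' (L₁' ++ L₂') + cross L₁' L₂'
        ≡⟨ cong (λ b → length L₁ * b + cross L₁' L₂') (sum-↭ (map⁺ (λ l → δ w l * δ w' l) leaves-↭)) ⟨
      length L₁ * both w w' (L₁ ++ L₂) + cross L₁' L₂' ∎)
      where
      open ≡-Reasoning
      X = mark S₁
      ψ : Monomial → ℕ
      ψ m = (# w) m * (# w') m
      φ = select 4 2 (avoid X ψ)
      cross : List ℕ → List ℕ → ℕ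
      cross L L' = count w L * count w' L' + count w' L * count w L'
      expand : ∀ L L' → length L ≡ length L₁ → length L' ≡ length L₁ →
        value φ X X L L' ≡ length L₁ * both w w' (L ++ L') + cross L L'
      expand L L' len len' = begin
        value φ X X L L'
          ≡⟨ leaf-pair-count w w' {X} two L L' ⟩
        _ ≡⟨ pair-sum-expand w w' L L' ⟩
        (length L' * both w w' L + length L * both w w' L') + cross L L'
          ≡⟨ cong₂ (λ a b → (a * both w w' L + b * both w w' L') + cross L L') len' len ⟩
        (length L₁ * both w w' L + length L₁ * both w w' L') + cross L L'
          ≡⟨ cong (_+ cross L L') (*-distribˡ-+ (length L₁) (both w w' L) (both w w' L')) ⟨
        length L₁ * (both w w' L + both w w' L') + cross L L'
          ≡⟨ cong (λ b → length L₁ * b + cross L L') (≡-trans (cong sum (map-++ _ L L')) (sum-++ (map _ L) _)) ⟨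
        length L₁ * both w w' (L ++ L') + cross L L' ∎

    equal-marks : (S₁ ≅ S₁' × S₂ ≅ S₂') ⊎ (S₁ ≅ S₂' × S₂ ≅ S₁')
    equal-marks with ↭-or-count-differs L₁ L₁'
    ... | inj₁ p = inj₁ (≅-from-leaves e₁ p , ≅-from-leaves e₂ (count-ext _ _ λ w →
            +-cancelˡ-≡ (count w L₁) _ _
              (≡-trans (leaves-count w) (cong (_+ count w L₂') (≡-sym (count-↭ w p))))))
    ... | inj₂ (w₀ , ne) = inj₂
            ( ≅-from-leaves (≡-trans e e₂) (count-ext _ _ crossed)
            , ≅-from-leaves (≡-trans (≡-sym e) e₁) (count-ext _ _ crossed′))
      where
      -- At `w₀` the two roots of the quadratic are not matched in order, so they are exchanged.
      w₀-crossed : count w₀ L₁ ≡ count w₀ L₂'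
      w₀-crossed = equal-sum-product ne (leaves-count w₀)
        (≡-trans (cong (count w₀ L₁ * count w₀ L₂ +_) (*-comm (count w₀ L₂) _))
        (≡-trans (cross-count w₀ w₀)
                 (cong (count w₀ L₁' * count w₀ L₂' +_) (*-comm (count w₀ L₁') _))))
      swapped : ∀ w → count w L₁ ≡ count w L₂' → count w L₂ ≡ count w L₁'
      swapped w c = +-cancelʳ-≡ (count w L₂') _ _
        (≡-trans (+-comm (count w L₂) _)
        (≡-trans (cong (_+ count w L₂) (≡-sym c)) (leaves-count w)))
      w₀-crossed′ : count w₀ L₂ ≡ count w₀ L₁'
      w₀-crossed′ = swapped w₀ w₀-crossed
      crossed : ∀ w → count w L₁ ≡ count w L₂'
      -- Equal `p` and `q` would give `count w₀ L₁ ≡ count w₀ L₁'`, against the choice of `w₀`.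
      crossed w = cross-cancel {p = count w₀ L₁} {q = count w₀ L₂}
        (λ p≡q → ne (≡-trans p≡q w₀-crossed′)) (leaves-count w)
        (≡-trans (cross-count w w₀)
          (cong₂ (λ p q → count w L₁' * p + q * count w L₂') (≡-sym w₀-crossed) (≡-sym w₀-crossed′)))
      crossed′ : ∀ w → count w L₂ ≡ count w L₁'
      crossed′ w = swapped w (crossed w)

-- One leaf on each side: paths on four vertices.

module _ {F α l β m α' l' β' m'}
         (real : Realises F (star α [ l ]) (star β [ m ]))
         (real' : Realises F (star α' [ l' ]) (star β' [ m' ])) where

  path-end-weights : l ∷ m ∷ [] ↭ l' ∷ m' ∷ []
  path-end-weights = leaves-↭ real real' (s≤s z≤n) (s≤s z≤n) (s≤s z≤n) (s≤s z≤n)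

  path-weights : α ∷ β ∷ l ∷ m ∷ [] ↭ α' ∷ β' ∷ l' ∷ m' ∷ []
  path-weights = count-ext _ _ λ w →
    ≡-trans (≡-sym (path-weight-count w α l β m))
    (≡-trans (compare real real' (s≤s z≤n) (s≤s z≤n) (s≤s z≤n) (s≤s z≤n) (select 4 4 (# w))
                (select-invariant 4 4 {φ = # w} (#-invariant w)))
             (path-weight-count w α' l' β' m'))

  path-inner-weights : α ∷ β ∷ [] ↭ α' ∷ β' ∷ []
  path-inner-weights = count-ext _ _ λ w → +-cancelʳ-≡ (count w (l ∷ m ∷ [])) _ _
    (≡-trans (≡-sym (count-++ w (α ∷ β ∷ []) (l ∷ m ∷ []))) (≡-trans (count-↭ w path-weights)
    (≡-trans (count-++ w (α' ∷ β' ∷ []) (l' ∷ m' ∷ []))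
             (cong (count w (α' ∷ β' ∷ []) +_) (≡-sym (count-↭ w path-end-weights))))))

  path-reconstruction :
    mark (star α [ l ]) ≡ mark (star α' [ l' ]) → mark (star β [ m ]) ≡ mark (star β' [ m' ]) →
    (star α [ l ] ≅ star α' [ l' ] × star β [ m ] ≅ star β' [ m' ]) ⊎
    (star α [ l ] ≅ star β' [ m' ] × star β [ m ] ≅ star α' [ l' ])
  path-reconstruction e₁ e₂ with ↭-pair path-end-weights | ↭-pair path-inner-weights
  ... | inj₁ (refl , refl) | _                  = inj₁ (≅-from-leaves e₁ refl , ≅-from-leaves e₂ refl)
  ... | inj₂ (refl , refl) | inj₂ (refl , refl) = inj₂ ((refl , refl) , (refl , refl))
  -- The leaves are exchanged but the centres are not: the first marks give `α + l = α + m`, so the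
  -- leaves weigh the same.
  ... | inj₂ (refl , refl) | inj₁ (refl , refl)
    with +-cancelʳ-≡ 0 l m (+-cancelˡ-≡ α (l + 0) (m + 0) (cong proj₁ e₁))
  ...   | refl = inj₁ ((refl , refl) , (refl , refl))

-- Combination of the cases.

-- `distinct-marks` needs two leaves on the second star. If only the first has them, the stars
-- change roles, which is why realisations in both orders are supplied.
oriented-reconstruction : ∀ {F S₁ S₂ S₁' S₂'} →
  Realises F S₁ S₂ → Realises F S₂ S₁ → Realises F S₁' S₂' → Realises F S₂' S₁' →
  Leafy S₁ → Leafy S₂ → Leafy S₁' → Leafy S₂' → mark S₁ ≡ mark S₁' → mark S₂ ≡ mark S₂' →
  (S₁ ≅ S₁' × S₂ ≅ S₂') ⊎ (S₁ ≅ S₂' × S₂ ≅ S₁')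
oriented-reconstruction {S₁ = S₁} {S₂} r₁₂ r₂₁ r₁₂' r₂₁' p₁ p₂ p₁' p₂' e₁ e₂
  with mark S₁ ≟ᵐ mark S₂ | 2 ≤? length (leaves S₁) | 2 ≤? length (leaves S₂)
... | yes e | yes two | _       = equal-marks r₁₂ r₁₂' p₁ p₂ p₁' p₂' e₁ e₂ e two
... | no ne | _       | yes two = inj₁ (distinct-marks r₁₂ r₁₂' p₁ p₂ p₁' p₂' e₁ e₂ ne two)
... | no ne | yes two | no _    =
  inj₁ (Product.swap (distinct-marks r₂₁ r₂₁' p₂ p₁ p₂' p₁' e₂ e₁ (ne ∘ ≡-sym) two))
... | yes e | no one  | yes two = ⊥-elim (one (subst (2 ≤_) (cong proj₂ (≡-sym e)) two))
oriented-reconstruction {S₁ = star α (l ∷ [])} {star β (m ∷ [])} {star α' (l' ∷ [])} {star β' (m' ∷ [])}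
  r₁₂ r₂₁ r₁₂' r₂₁' p₁ p₂ p₁' p₂' e₁ e₂ | _ | no _ | no _ = path-reconstruction r₁₂ r₁₂' e₁ e₂
oriented-reconstruction {S₁ = star _ (_ ∷ _ ∷ _)} _ _ _ _ _ _ _ _ _ _ | _ | no one | no _ =
  ⊥-elim (one (s≤s (s≤s z≤n)))
oriented-reconstruction {S₂ = star _ (_ ∷ _ ∷ _)} _ _ _ _ _ _ _ _ _ _ | _ | no _ | no one =
  ⊥-elim (one (s≤s (s≤s z≤n)))

reconstruction : ∀ {F S₁ S₂ S₁' S₂'} →
  Realises F S₁ S₂ → Realises F S₂ S₁ → Realises F S₁' S₂' → Realises F S₂' S₁' →
  Leafy S₁ → Leafy S₂ → Leafy S₁' → Leafy S₂' →
  (S₁ ≅ S₁' × S₂ ≅ S₂') ⊎ (S₁ ≅ S₂' × S₂ ≅ S₁')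
reconstruction r₁₂ r₂₁ r₁₂' r₂₁' p₁ p₂ p₁' p₂' with marks-agree r₁₂ r₁₂' p₁ p₂ p₁' p₂'
... | inj₁ (e₁ , e₂) = oriented-reconstruction r₁₂ r₂₁ r₁₂' r₂₁' p₁ p₂ p₁' p₂' e₁ e₂
... | inj₂ (e₁ , e₂) = Sum.swap (oriented-reconstruction r₁₂ r₂₁ r₂₁' r₁₂' p₁ p₂ p₂' p₁' e₁ e₂)

-- The monomial of an edge set with prescribed components

unique-set⇒↭ : {X : Set} {xs ys : List X} → Unique xs → Unique ys →
  (∀ {v} → v ∈ xs → v ∈ ys) → (∀ {v} → v ∈ ys → v ∈ xs) → xs ↭ ys
unique-set⇒↭ p q f g = ∼bag⇒↭ (unique∧set⇒bag p q (mk⇔ f g))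

module _ {X : Set} where

  unique-resp-↭ : {xs ys : List X} → xs ↭ ys → Unique xs → Unique ys
  unique-resp-↭ p = Unique-resp-↭ (↭⇒↭ₛ p)
    where open Permutationₛ (setoid X)

  unique-++⁻ˡ : ∀ (xs : List X) {ys} → Unique (xs ++ ys) → Unique xs
  unique-++⁻ˡ []       _       = []
  unique-++⁻ˡ (x ∷ xs) (p ∷ u) = All.++⁻ˡ xs p ∷ unique-++⁻ˡ xs u

  unique-++⁻ʳ : ∀ (xs : List X) {ys} → Unique (xs ++ ys) → Unique ys
  unique-++⁻ʳ []       u       = u
  unique-++⁻ʳ (x ∷ xs) (_ ∷ u) = unique-++⁻ʳ xs u

  unique-++⇒disjoint : ∀ (xs : List X) {ys v} → Unique (xs ++ ys) → v ∈ xs → v ∉ ys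
  unique-++⇒disjoint (x ∷ xs) (p ∷ _) (here refl) v∈ys = All.lookup p (∈-++⁺ʳ xs v∈ys) refl
  unique-++⇒disjoint (x ∷ xs) (_ ∷ u) (there v∈)  v∈ys = unique-++⇒disjoint xs u v∈ v∈ys

T-does : {P : Set} (p? : Dec P) → T (does p?) → P
T-does (yes p) _ = p

does-T : {P : Set} (p? : Dec P) → P → T (does p?)
does-T (yes _) _ = _
does-T (no ¬p) p = ¬p p

module _ {n} (A : List (Fin n × Fin n)) where

  Joined : Fin n → Fin n → Set
  Joined u v = (u , v) ∈ A ⊎ (v , u) ∈ A

  Joined-sym : ∀ {u v} → Joined u v → Joined v u
  Joined-sym (inj₁ p) = inj₂ p
  Joined-sym (inj₂ p) = inj₁ p

  -- The index only bounds the length, as `stay` fits every index; likewise `step` keeps the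
  -- vertices already reached.
  data Walk (u : Fin n) : ℕ → Fin n → Set where
    stay : ∀ {k} → Walk u k u
    _▸_  : ∀ {k v w} → Walk u k v → Joined v w → Walk u (suc k) w

  _◅_ : ∀ {u v w k} → Joined u v → Walk v k w → Walk u (suc k) w
  e ◅ stay    = stay ▸ e
  e ◅ (p ▸ f) = (e ◅ p) ▸ f

  Walk-sym : ∀ {u v k} → Walk u k v → Walk v k u
  Walk-sym stay    = stay
  Walk-sym (p ▸ e) = Joined-sym e ◅ Walk-sym p

  Walk-weaken : ∀ {u v j k} → j ≤ k → Walk u j v → Walk u k v
  Walk-weaken j≤k       stay    = stay
  Walk-weaken (s≤s j≤k) (p ▸ e) = Walk-weaken j≤k p ▸ e

  Walk-trans : ∀ {u v w j k} → Walk u j v → Walk v k w → Walk u (k + j) w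
  Walk-trans {j = j} {k} p stay = Walk-weaken (m≤n+m j k) p
  Walk-trans p (q ▸ e)          = Walk-trans p q ▸ e

  step⁻ : ∀ S {v} → T (step A S v) → T (S v) ⊎ ∃ λ u → T (S u) × Joined u v
  step⁻ S {v} t with to (T-∨ {S v}) t
  ... | inj₁ s = inj₁ s
  ... | inj₂ a with find (any⁻ _ A a)
  ...   | (p , q) , e∈A , r with to (T-∨ {S p ∧ (q == v)}) r
  ...     | inj₁ pq with to (T-∧ {S p}) pq
  ...       | s , q≡v with T-does (q Fin.≟ v) q≡v
  ...         | refl = inj₂ (p , s , inj₁ e∈A)
  step⁻ S {v} t | inj₂ a | (p , q) , e∈A , r | inj₂ qp with to (T-∧ {S q}) qp
  ...       | s , p≡v with T-does (p Fin.≟ v) p≡v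
  ...         | refl = inj₂ (q , s , inj₂ e∈A)

  step⁺ : ∀ S {u v} → T (S u) → Joined u v → T (step A S v)
  step⁺ S {u} {v} s j = from (T-∨ {S v}) (inj₂ (any⁺ _ (edge j)))
    where
    edge : Joined u v → _
    edge (inj₁ e∈A) = lose e∈A (from (T-∨ {S u ∧ (v == v)})
                        (inj₁ (from (T-∧ {S u}) (s , does-T (v Fin.≟ v) refl))))
    edge (inj₂ e∈A) = lose e∈A (from (T-∨ {S v ∧ (u == v)})
                        (inj₂ (from (T-∧ {S u}) (s , does-T (v Fin.≟ v) refl))))

  reach : Fin n → ℕ → Fin n → Bool
  reach u k = iter k (step A) (u ==_)

  Walk⇒reach : ∀ {u k v} → Walk u k v → T (reach u k v)
  Walk⇒reach {u} {zero}  stay = does-T (u Fin.≟ u) refl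
  Walk⇒reach {u} {suc k} stay = from (T-∨ {reach u k u}) (inj₁ (Walk⇒reach {u} {k} stay))
  Walk⇒reach {u} {suc k} (p ▸ e) = step⁺ (reach u k) (Walk⇒reach p) e

  -- Applied with `P` the vertex set of a prescribed component, this confines reachability to that
  -- component.
  reach-closed : ∀ {P : Fin n → Set} → (∀ {p q} → Joined p q → P p → P q) →
                 ∀ {u} k {v} → P u → T (reach u k v) → P v
  reach-closed closed {u} zero {v} pu t with T-does (u Fin.≟ v) t
  ... | refl = pu
  reach-closed closed {u} (suc k) pu t with step⁻ (reach u k) t
  ... | inj₁ s           = reach-closed closed k pu s
  ... | inj₂ (w , s , e) = closed e (reach-closed closed k pu s)

  ∈-reps⁺ : ∀ {v} → (∀ {u} → u Fin.< v → ¬ T (conn A u v)) → v ∈ reps A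
  ∈-reps⁺ {v} h = ∈-filter⁺ _ (∈-allFin v) (to T-≡ (from T-not-≡ (none _ refl)))
    where
    none : ∀ b → any (λ u → does (u Fin.<? v) ∧ conn A u v) (allFin n) ≡ b → b ≡ false
    none false _ = refl
    none true  e with find (any⁻ _ (allFin n) (from T-≡ e))
    ... | u , _ , t with to (T-∧ {does (u Fin.<? v)}) t
    ...   | u<v , c = ⊥-elim (h (T-does (u Fin.<? v) u<v) c)

  ∈-reps⁻ : ∀ {v} → v ∈ reps A → ∀ {u} → u Fin.< v → ¬ T (conn A u v)
  ∈-reps⁻ {v} v∈ {u} u<v c
    with proj₂ (∈-filter⁻
           (λ v → not (any (λ u → does (u Fin.<? v) ∧ conn A u v) (allFin n)) Bool.≟ true)
           {xs = allFin n} v∈)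
  ... | e with any (λ u → does (u Fin.<? v) ∧ conn A u v) (allFin n)
             | any⁺ (λ u → does (u Fin.<? v) ∧ conn A u v)
                 (lose (∈-allFin u) (from (T-∧ {does (u Fin.<? v)}) (does-T (u Fin.<? v) u<v , c)))
  ∈-reps⁻ v∈ u<v c | () | true  | _
  ∈-reps⁻ v∈ u<v c | _  | false | ()

dotSum-mω : ∀ {n} (ω : Fin n → ℕ) x xs →
  dotSum (map (mω ω) (x ∷ xs)) ≡ (sum (map ω (x ∷ xs)) , length xs)
dotSum-mω ω x xs = go (ω x) 0 xs
  where
  go : ∀ w d ys → foldl _∔_ (w , d) (map (mω ω) ys) ≡ (w + sum (map ω ys) , d + length ys)
  go w d []       = cong₂ _,_ (≡-sym (+-identityʳ w)) (≡-sym (+-identityʳ d))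
  go w d (y ∷ ys) = ≡-trans (go (w + ω y) (d + 0 + 1) ys)
    (cong₂ _,_ (+-assoc w (ω y) _)
      (≡-trans (cong (_+ length ys) (cong (_+ 1) (+-identityʳ d))) (+-assoc d 1 _)))

-- A nonempty vertex set with a distinguished vertex, from which walks to the others start; the
-- length of the list is the second coordinate of the mark.
Component : ℕ → Set
Component n = Fin n × List (Fin n)

vertices : ∀ {n} → Component n → List (Fin n)
vertices (x , xs) = x ∷ xs

componentMark : ∀ {n} → (Fin n → ℕ) → Component n → Mark
componentMark ω (x , xs) = sum (map ω (x ∷ xs)) , length xs

dotSum-component : ∀ {n} (ω : Fin n → ℕ) C {us} → us ↭ vertices C →
  dotSum (map (mω ω) us) ≡ componentMark ω C
dotSum-component ω (x , xs) {[]}     p with ↭-length p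
... | ()
dotSum-component ω (x , xs) {u ∷ us} p = ≡-trans (dotSum-mω ω u us)
  (cong₂ _,_ (sum-↭ (map⁺ ω p)) (suc-injective (↭-length p)))

monomial : ∀ {n} → (Fin n → ℕ) → List (Fin n × Fin n) → Monomial
monomial ω A = map (λ r → dotSum (map (mω ω) (members A r))) (reps A)

-- `Cs` is certified as the list of components: `partition` and `inside` prevent connections between
-- its members, `near` connects each one. Two vertices of a component are at most 4 steps apart
-- through the distinguished one, and `conn` makes `n` steps, hence `4≤n`.
module _ {n} (A : List (Fin n × Fin n)) (Cs : List (Component n))
  (4≤n : 4 ≤ n)
  (partition : concatMap vertices Cs ↭ allFin n)
  (inside : ∀ {p q} → (p , q) ∈ A → ∃ λ C → C ∈ Cs × p ∈ vertices C × q ∈ vertices C)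
  (near : ∀ {C v} → C ∈ Cs → v ∈ vertices C → Walk A (proj₁ C) 2 v)
  where

  open import Data.List.Extrema (Fin.≤-totalOrder n) using (min; min≤⊤; min≤xs; argmin-sel)

  private
    disjoint : Unique (concatMap vertices Cs)
    disjoint = unique-resp-↭ (↭-sym partition) (Unique.allFin⁺ n)

    cover : ∀ v → ∃ λ C → C ∈ Cs × v ∈ vertices C
    cover v = find (∈-concatMap⁻ vertices (∈-resp-↭ (↭-sym partition) (∈-allFin v)))

    ∈-union : ∀ {Cs : List (Component n)} {C v} → C ∈ Cs → v ∈ vertices C → v ∈ concatMap vertices Cs
    ∈-union             (here refl) v∈ = ∈-++⁺ˡ v∈
    ∈-union {D ∷ Cs} (there C∈)  v∈ = ∈-++⁺ʳ (vertices D) (∈-union C∈ v∈)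

    component-unique : ∀ {Cs : List (Component n)} {C D v} → Unique (concatMap vertices Cs) →
      C ∈ Cs → D ∈ Cs → v ∈ vertices C → v ∈ vertices D → C ≡ D
    component-unique u (here refl) (here refl) v∈C v∈D = refl
    component-unique {C ∷ _} u (here refl) (there D∈) v∈C v∈D =
      ⊥-elim (unique-++⇒disjoint (vertices C) u v∈C (∈-union D∈ v∈D))
    component-unique {D ∷ _} u (there C∈) (here refl) v∈C v∈D =
      ⊥-elim (unique-++⇒disjoint (vertices D) u v∈D (∈-union C∈ v∈C))
    component-unique {E ∷ _} u (there C∈) (there D∈) v∈C v∈D =
      component-unique (unique-++⁻ʳ (vertices E) u) C∈ D∈ v∈C v∈D

    component-noRepeats : ∀ {Cs : List (Component n)} {C} → Unique (concatMap vertices Cs) →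
      C ∈ Cs → Unique (vertices C)
    component-noRepeats {C ∷ _} u (here refl) = unique-++⁻ˡ (vertices C) u
    component-noRepeats {E ∷ _} u (there C∈)  = component-noRepeats (unique-++⁻ʳ (vertices E) u) C∈

    conn⁺ : ∀ {C u v} → C ∈ Cs → u ∈ vertices C → v ∈ vertices C → T (conn A u v)
    conn⁺ C∈ u∈ v∈ = Walk⇒reach A (Walk-weaken A 4≤n
      (Walk-trans A (Walk-sym A (near C∈ u∈)) (near C∈ v∈)))

    conn⁻ : ∀ {C u v} → C ∈ Cs → u ∈ vertices C → T (conn A u v) → v ∈ vertices C
    conn⁻ {C} C∈ = reach-closed A {P = _∈ vertices C} closed n
      where
      closed : ∀ {p q} → Joined A p q → p ∈ vertices C → q ∈ vertices C
      closed (inj₁ e) p∈ with inside e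
      ... | D , D∈ , p∈D , q∈D with component-unique disjoint C∈ D∈ p∈ p∈D
      ...   | refl = q∈D
      closed (inj₂ e) p∈ with inside e
      ... | D , D∈ , q∈D , p∈D with component-unique disjoint C∈ D∈ p∈ p∈D
      ...   | refl = q∈D

    -- `reps` keeps the vertices connected to no smaller vertex, that is, the least vertex of each
    -- component.
    least : Component n → Fin n
    least (x , xs) = min x xs

    least-∈ : ∀ C → least C ∈ vertices C
    least-∈ (x , xs) with argmin-sel (λ v → v) x xs
    ... | inj₁ e = here e
    ... | inj₂ m = there m

    least-≤ : ∀ C {v} → v ∈ vertices C → least C Fin.≤ v
    least-≤ (x , xs) (here refl) = min≤⊤ x xs
    least-≤ (x , xs) (there v∈)  = All.lookup (min≤xs x xs) v∈

    members-↭ : ∀ {C} → C ∈ Cs → members A (least C) ↭ vertices C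
    members-↭ {C} C∈ = unique-set⇒↭
      (Unique.filter⁺ _ (Unique.allFin⁺ n))
      (component-noRepeats disjoint C∈)
      (λ v∈ → conn⁻ C∈ (least-∈ C) (from T-≡ (proj₂ (∈-filter⁻ _ {xs = allFin n} v∈))))
      (λ {v} v∈ → ∈-filter⁺ _ (∈-allFin v) (to T-≡ (conn⁺ C∈ (least-∈ C) v∈)))

    leasts-unique : ∀ {Cs : List (Component n)} → Unique (concatMap vertices Cs) → Unique (map least Cs)
    leasts-unique {[]}     u = []
    leasts-unique {C ∷ Cs} u = All.map⁺ (All.tabulate λ {D} D∈ e →
        unique-++⇒disjoint (vertices C) u (least-∈ C)
          (∈-union D∈ (subst (_∈ vertices D) (≡-sym e) (least-∈ D))))
      ∷ leasts-unique {Cs} (unique-++⁻ʳ (vertices C) u)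

    reps-↭ : reps A ↭ map least Cs
    reps-↭ = unique-set⇒↭ (Unique.filter⁺ _ (Unique.allFin⁺ n)) (leasts-unique disjoint) ⊆ ⊇
      where
      ⊆ : ∀ {v} → v ∈ reps A → v ∈ map least Cs
      ⊆ {v} v∈ with cover v
      ... | C , C∈ , v∈C with least C Fin.≟ v
      ...   | yes refl = ∈-map⁺ least C∈
      ...   | no ne    = ⊥-elim (∈-reps⁻ A v∈ (Fin.≤∧≢⇒< (least-≤ C v∈C) ne) (conn⁺ C∈ (least-∈ C) v∈C))
      ⊇ : ∀ {v} → v ∈ map least Cs → v ∈ reps A
      ⊇ v∈ with ∈-map⁻ least v∈
      ... | C , C∈ , refl = ∈-reps⁺ A minimal
        where
        minimal : ∀ {u} → u Fin.< least C → ¬ T (conn A u (least C))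
        minimal {u} u<l c with cover u
        ... | D , D∈ , u∈D with component-unique disjoint C∈ D∈ (least-∈ C) (conn⁻ D∈ u∈D c)
        ...   | refl = <⇒≱ u<l (least-≤ C u∈D)

  monomial-components : ∀ ω → monomial ω A ↭ map (componentMark ω) Cs
  monomial-components ω = ↭-trans (map⁺ f reps-↭) (↭-reflexive (go Cs (λ C∈ → C∈)))
    where
    f : Fin n → Mark
    f r = dotSum (map (mω ω) (members A r))
    go : ∀ Ds → (∀ {C} → C ∈ Ds → C ∈ Cs) → map f (map least Ds) ≡ map (componentMark ω) Ds
    go []       _ = refl
    go (C ∷ Ds) i = cong₂ _∷_ (dotSum-component ω C (members-↭ (i (here refl)))) (go Ds (i ∘ there))

-- The M-polynomial of a 2-star

Σ⊆-subsets : {X : Set} (xs : List X) (g : List X → ℕ) → sum (map g (subsets xs)) ≡ Σ⊆ xs g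
Σ⊆-subsets []       g = +-identityʳ (g [])
Σ⊆-subsets (x ∷ xs) g = begin
  sum (map g (r ++ map (x ∷_) r))                    ≡⟨ cong sum (map-++ g r _) ⟩
  sum (map g r ++ map g (map (x ∷_) r))              ≡⟨ sum-++ (map g r) _ ⟩
  sum (map g r) + sum (map g (map (x ∷_) r))         ≡⟨ cong (λ z → sum (map g r) + sum z) (map-∘ r) ⟨
  sum (map g r) + sum (map (g ∘ (x ∷_)) r)           ≡⟨ cong₂ _+_ (Σ⊆-subsets xs g) (Σ⊆-subsets xs (g ∘ (x ∷_))) ⟩
  Σ⊆ (x ∷ xs) g                                      ∎
  where
  open ≡-Reasoning
  r = subsets xs

Σ⊆-↭ : {X : Set} {xs ys : List X} {g : List X → ℕ} → (∀ {s t} → s ↭ t → g s ≡ g t) →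
       xs ↭ ys → Σ⊆ xs g ≡ Σ⊆ ys g
Σ⊆-↭ inv refl        = refl
Σ⊆-↭ inv (prep x p)  = cong₂ _+_ (Σ⊆-↭ inv p) (Σ⊆-↭ (inv ∘ prep x) p)
Σ⊆-↭ {xs = _ ∷ _ ∷ xs} {g = g} inv (swap x y p) = ≡-trans
  (+-interchange (Σ⊆ xs g) _ _ _)
  (cong₂ _+_ (cong₂ _+_ (Σ⊆-↭ inv p) (Σ⊆-↭ (inv ∘ prep x) p))
             (cong₂ _+_ (Σ⊆-↭ (inv ∘ prep y) p)
                        (≡-trans (Σ⊆-cong xs λ t → inv (swap x y refl))
                                 (Σ⊆-↭ (inv ∘ prep y ∘ prep x) p))))
Σ⊆-↭ inv (trans p q) = ≡-trans (Σ⊆-↭ inv p) (Σ⊆-↭ inv q)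

Σ⊆-++ : {X : Set} (xs ys : List X) (g : List X → ℕ) →
        Σ⊆ (xs ++ ys) g ≡ Σ⊆ xs (λ s → Σ⊆ ys (λ t → g (s ++ t)))
Σ⊆-++ []       ys g = refl
Σ⊆-++ (x ∷ xs) ys g = cong₂ _+_ (Σ⊆-++ xs ys g) (Σ⊆-++ xs ys (g ∘ (x ∷_)))

Σ⊆-map : {X Y : Set} (f : X → Y) (xs : List X) (g : List Y → ℕ) → Σ⊆ (map f xs) g ≡ Σ⊆ xs (g ∘ map f)
Σ⊆-map f []       g = refl
Σ⊆-map f (x ∷ xs) g = cong₂ _+_ (Σ⊆-map f xs g) (Σ⊆-map f xs (g ∘ (f x ∷_)))

-- Taking complements permutes the sublists. The M-polynomial runs over the edges kept, `value` over
-- the leaves cut off.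
Σ⊆-complement : {X : Set} (xs : List X) {g h : List X → ℕ} →
  (∀ s t → s ++ t ↭ xs → g s ≡ h t) → Σ⊆ xs g ≡ Σ⊆ xs h
Σ⊆-complement []       e = e [] [] refl
Σ⊆-complement (x ∷ xs) {g} {h} e = ≡-trans
  (cong₂ _+_ (Σ⊆-complement xs λ s t p → e s (x ∷ t) (↭-trans (shift x s t) (prep x p)))
             (Σ⊆-complement xs λ s t p → e (x ∷ s) t (prep x p)))
  (+-comm (Σ⊆ xs (h ∘ (x ∷_))) (Σ⊆ xs h))

any-cong : {X : Set} {p q : X → Bool} → (∀ x → p x ≡ q x) → ∀ xs → any p xs ≡ any q xs
any-cong e []       = refl
any-cong e (x ∷ xs) = cong₂ _∨_ (e x) (any-cong e xs)

any-↭ : {X : Set} (p : X → Bool) {xs ys : List X} → xs ↭ ys → any p xs ≡ any p ys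
any-↭ p refl         = refl
any-↭ p (prep x r)   = cong (p x ∨_) (any-↭ p r)
any-↭ p {_ ∷ _ ∷ xs} (swap x y r) = ≡-trans (≡-sym (∨-assoc (p x) (p y) (any p xs)))
  (≡-trans (cong₂ _∨_ (∨-comm (p x) (p y)) (any-↭ p r)) (∨-assoc (p y) (p x) _))
any-↭ p (trans r s)  = ≡-trans (any-↭ p r) (any-↭ p s)

filter-true-cong : {X : Set} {f g : X → Bool} → (∀ x → f x ≡ g x) → ∀ xs →
  filter (λ x → f x Bool.≟ true) xs ≡ filter (λ x → g x Bool.≟ true) xs
filter-true-cong e xs = filter-≐ _ _ ((λ {x} → ≡-trans (≡-sym (e x))) , (λ {x} → ≡-trans (e x))) xs

module _ {n} {A B : List (Fin n × Fin n)} (p : A ↭ B) where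

  conn-↭ : ∀ u v → conn A u v ≡ conn B u v
  conn-↭ u = go n
    where
    go : ∀ k v → iter k (step A) (u ==_) v ≡ iter k (step B) (u ==_) v
    go zero    v = refl
    go (suc k) v = cong₂ _∨_ (go k v) (≡-trans (any-↭ _ p) (any-cong (λ e →
      cong₂ _∨_ (cong (_∧ (proj₂ e == v)) (go k (proj₁ e)))
                (cong (_∧ (proj₁ e == v)) (go k (proj₂ e)))) B))

  monomial-↭ : ∀ ω → monomial ω A ≡ monomial ω B
  monomial-↭ ω = ≡-trans
    (map-cong (λ r → cong (dotSum ∘ map (mω ω)) (filter-true-cong (conn-↭ r) (allFin n))) (reps A))
    (cong (map (λ r → dotSum (map (mω ω) (members B r))))
      (filter-true-cong (λ v → cong not (any-cong (λ u → cong (does (u Fin.<? v) ∧_) (conn-↭ u v)) (allFin n)))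
        (allFin n)))

-- The smaller end comes first, as in the list `edges`.
edge : ∀ {n} → Fin n → Fin n → Fin n × Fin n
edge u v = if does (u Fin.<? v) then (u , v) else (v , u)

edge-cases : ∀ {n} (u v : Fin n) → edge u v ≡ (u , v) ⊎ edge u v ≡ (v , u)
edge-cases u v with does (u Fin.<? v)
... | true  = inj₁ refl
... | false = inj₂ refl

edge-joined : ∀ {n} {A : List (Fin n × Fin n)} u v → edge u v ∈ A → Joined A u v
edge-joined {A = A} u v e with edge-cases u v
... | inj₁ q = inj₁ (subst (_∈ A) q e)
... | inj₂ q = inj₂ (subst (_∈ A) q e)

edge-ends : ∀ {n} {P : Fin n → Set} {p q} u v → (p , q) ≡ edge u v → P u → P v → P p × P q
edge-ends u v e pu pv with edge-cases u v
... | inj₁ r with ≡-trans e r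
...   | refl = pu , pv
edge-ends u v e pu pv | inj₂ r with ≡-trans e r
...   | refl = pv , pu

module _ {n} (ω : Fin n → ℕ) (c₁ c₂ : Fin n) (l₁ l₂ : List (Fin n))
  (all-vertices : c₁ ∷ c₂ ∷ l₁ ++ l₂ ↭ allFin n)
  (nonempty₁ : 1 ≤ length l₁) (nonempty₂ : 1 ≤ length l₂) where

  private
    L₁ = map ω l₁
    L₂ = map ω l₂
    S₁ = star (ω c₁) L₁
    S₂ = star (ω c₂) L₂
    X = mark S₁
    Y = mark S₂

    4≤n : 4 ≤ n
    4≤n = subst (4 ≤_) (≡-trans (↭-length all-vertices) (length-tabulate {n = n} (λ i → i)))
      (s≤s (s≤s (subst (2 ≤_) (≡-sym (length-++ l₁)) (+-mono-≤ nonempty₁ nonempty₂))))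

    singles : List (Fin n) → List (Component n)
    singles = map (_, [])

    singles-vertices : ∀ t → concatMap vertices (singles t) ≡ t
    singles-vertices []      = refl
    singles-vertices (v ∷ t) = cong (v ∷_) (singles-vertices t)

    singles-near : ∀ {A C v} t → C ∈ singles t → v ∈ vertices C → Walk A (proj₁ C) 2 v
    singles-near t C∈ v∈ with ∈-map⁻ (_, []) C∈
    singles-near t C∈ (here refl) | _ , _ , refl = stay

    singles-mark : ∀ t → map (componentMark ω) (singles t) ≡ atoms (map ω t)
    singles-mark []      = refl
    singles-mark (v ∷ t) = cong₂ _∷_ (cong (_, 0) (+-identityʳ (ω v))) (singles-mark t)

    sum-split : ∀ {l} s t → s ++ t ↭ l → sum (map ω l) ≡ sum (map ω s) + sum (map ω t)
    sum-split s t p = ≡-trans (≡-sym (sum-↭ (map⁺ ω p)))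
      (≡-trans (cong sum (map-++ ω s t)) (sum-++ (map ω s) (map ω t)))

    length-split : ∀ {l} s t → s ++ t ↭ l → length (map ω l) ≡ length s + length (map ω t)
    length-split {l} s t p = ≡-trans (length-map ω l) (≡-trans (≡-sym (↭-length p))
      (≡-trans (length-++ s) (cong (length s +_) (≡-sym (length-map ω t)))))

    star-remove : ∀ c {l} s t → s ++ t ↭ l →
      componentMark ω (c , s) ≡ remove (mark (star (ω c) (map ω l))) (map ω t)
    star-remove c s t p rewrite sum-split s t p | length-split s t p =
      cong₂ _,_ (≡-trans (≡-sym (m+n∸n≡m _ (sum (map ω t))))
                         (cong (_∸ sum (map ω t)) (+-assoc (ω c) _ _)))
                (≡-sym (m+n∸n≡m (length s) (length (map ω t))))

  -- `s₁` and `s₂` are the leaves that keep their edge, `t₁` and `t₂` those cut off.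
  module _ (s₁ t₁ s₂ t₂ : List (Fin n)) (p₁ : s₁ ++ t₁ ↭ l₁) (p₂ : s₂ ++ t₂ ↭ l₂) where

    private
      kept : List (Fin n × Fin n)
      kept = map (edge c₁) s₁ ++ map (edge c₂) s₂

      regroup : c₁ ∷ c₂ ∷ (s₁ ++ s₂) ++ (t₁ ++ t₂) ↭ allFin n
      regroup = ↭-trans (prep c₁ (prep c₂ (↭-trans (interchange s₁ s₂ t₁ t₂) (++⁺ p₁ p₂)))) all-vertices
        where open CommutativeSemigroup (CommutativeMonoid.commutativeSemigroup (++-commutativeMonoid {A = Fin n}))

      Cs Ds : List (Component n)
      Cs = (c₁ , s₁) ∷ (c₂ , s₂) ∷ singles (t₁ ++ t₂)
      Ds = (c₁ , c₂ ∷ s₁ ++ s₂) ∷ singles (t₁ ++ t₂)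

    monomial-uncentral : monomial ω kept ↭
      remove X (map ω t₁) ∷ remove Y (map ω t₂) ∷ atoms (map ω t₁ ++ map ω t₂)
    monomial-uncentral = ↭-trans (monomial-components kept Cs 4≤n parts inside near ω)
      (↭-reflexive (cong₂ _∷_ (star-remove c₁ s₁ t₁ p₁) (cong₂ _∷_ (star-remove c₂ s₂ t₂ p₂)
        (≡-trans (singles-mark (t₁ ++ t₂)) (cong atoms (map-++ ω t₁ t₂))))))
      where
      parts : concatMap vertices Cs ↭ allFin n
      parts rewrite singles-vertices (t₁ ++ t₂) = ↭-trans (prep c₁ (↭-trans (shift c₂ s₁ _)
        (prep c₂ (↭-reflexive (≡-sym (List.++-assoc s₁ s₂ _)))))) regroup
      inside : ∀ {p q} → (p , q) ∈ kept → ∃ λ C → C ∈ Cs × p ∈ vertices C × q ∈ vertices C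
      inside e∈ with ∈-++⁻ (map (edge c₁) s₁) e∈
      ... | inj₁ i with ∈-map⁻ (edge c₁) i
      ...   | v , v∈ , e = _ , here refl , edge-ends {P = _∈ c₁ ∷ s₁} c₁ v e (here refl) (there v∈)
      inside e∈ | inj₂ i with ∈-map⁻ (edge c₂) i
      ...   | v , v∈ , e = _ , there (here refl) , edge-ends {P = _∈ c₂ ∷ s₂} c₂ v e (here refl) (there v∈)
      near : ∀ {C v} → C ∈ Cs → v ∈ vertices C → Walk kept (proj₁ C) 2 v
      near (here refl)         (here refl) = stay
      near (here refl)         (there v∈)  =
        stay ▸ edge-joined c₁ _ (∈-++⁺ˡ (∈-map⁺ (edge c₁) v∈))
      near (there (here refl)) (here refl) = stay
      near (there (here refl)) (there v∈)  =
        stay ▸ edge-joined c₂ _ (∈-++⁺ʳ (map (edge c₁) s₁) (∈-map⁺ (edge c₂) v∈))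
      near (there (there C∈))  v∈          = singles-near (t₁ ++ t₂) C∈ v∈

    monomial-central : monomial ω (edge c₁ c₂ ∷ kept) ↭
      remove (X ∔ Y) (map ω t₁ ++ map ω t₂) ∷ atoms (map ω t₁ ++ map ω t₂)
    monomial-central = ↭-trans (monomial-components (edge c₁ c₂ ∷ kept) Ds 4≤n parts inside near ω)
      (↭-reflexive (cong₂ _∷_ main
        (≡-trans (singles-mark (t₁ ++ t₂)) (cong atoms (map-++ ω t₁ t₂)))))
      where
      parts : concatMap vertices Ds ↭ allFin n
      parts rewrite singles-vertices (t₁ ++ t₂) = regroup
      inside : ∀ {p q} → (p , q) ∈ edge c₁ c₂ ∷ kept → ∃ λ C → C ∈ Ds × p ∈ vertices C × q ∈ vertices C
      inside (here e) = _ , here refl ,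
        edge-ends {P = _∈ c₁ ∷ c₂ ∷ s₁ ++ s₂} c₁ c₂ e (here refl) (there (here refl))
      inside (there e∈) with ∈-++⁻ (map (edge c₁) s₁) e∈
      ... | inj₁ i with ∈-map⁻ (edge c₁) i
      ...   | v , v∈ , e = _ , here refl ,
        edge-ends {P = _∈ c₁ ∷ c₂ ∷ s₁ ++ s₂} c₁ v e (here refl) (there (there (∈-++⁺ˡ v∈)))
      inside (there e∈) | inj₂ i with ∈-map⁻ (edge c₂) i
      ...   | v , v∈ , e = _ , here refl ,
        edge-ends {P = _∈ c₁ ∷ c₂ ∷ s₁ ++ s₂} c₂ v e (there (here refl)) (there (there (∈-++⁺ʳ s₁ v∈)))
      near : ∀ {C v} → C ∈ Ds → v ∈ vertices C → Walk (edge c₁ c₂ ∷ kept) (proj₁ C) 2 v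
      near (here refl) (here refl)         = stay
      near (here refl) (there (here refl)) = stay ▸ edge-joined c₁ c₂ (here refl)
      near (here refl) (there (there v∈)) with ∈-++⁻ s₁ v∈
      ... | inj₁ i = stay ▸ edge-joined c₁ _ (there (∈-++⁺ˡ (∈-map⁺ (edge c₁) i)))
      -- Leaves of the second star are reached from `c₁` through `c₂`; they account for the bound 2
      -- on the walks.
      ... | inj₂ i = (stay ▸ edge-joined c₁ c₂ (here refl))
                       ▸ edge-joined c₂ _ (there (∈-++⁺ʳ (map (edge c₁) s₁) (∈-map⁺ (edge c₂) i)))
      near (there C∈)  v∈                  = singles-near (t₁ ++ t₂) C∈ v∈
      main : componentMark ω (c₁ , c₂ ∷ s₁ ++ s₂) ≡ remove (X ∔ Y) (map ω t₁ ++ map ω t₂)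
      main rewrite sum-split s₁ t₁ p₁ | length-split s₁ t₁ p₁ | sum-split s₂ t₂ p₂ | length-split s₂ t₂ p₂
             | sum-++ (map ω t₁) (map ω t₂) | length-++ (map ω t₁) {map ω t₂}
             | map-++ ω s₁ s₂ | sum-++ (map ω s₁) (map ω s₂) | length-++ s₁ {s₂} =
        cong₂ _,_
          (≡-trans (≡-sym (m+n∸n≡m _ (sum (map ω t₁) + sum (map ω t₂))))
            (cong (_∸ (sum (map ω t₁) + sum (map ω t₂))) (weights (ω c₁) (ω c₂) (sum (map ω s₁)) _ _ _)))
          (≡-trans (≡-sym (m+n∸n≡m _ (length (map ω t₁) + length (map ω t₂))))
            (cong (_∸ (length (map ω t₁) + length (map ω t₂))) (sizes (length s₁) (length s₂) (length (map ω t₁)) _)))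
        where
        weights : ∀ a b s s' t t' → a + (b + (s + s')) + (t + t') ≡ a + (s + t) + (b + (s' + t'))
        weights = solve-∀
        -- The `suc` on the left counts `c₂`; the final 1 on the right is the one added by `∔`.
        sizes : ∀ s s' t t' → suc (s + s') + (t + t') ≡ s + t + (s' + t') + 1
        sizes = solve-∀

  star-edges : List (Fin n × Fin n)
  star-edges = map (edge c₁) (c₂ ∷ l₁) ++ map (edge c₂) l₂

  -- Once the central edge is kept or dropped, the choices in the two stars are independent, and
  -- complements turn leaves kept into leaves cut off.
  Σ⊆-star-edges : ∀ φ → Invariant φ → Σ⊆ star-edges (φ ∘ monomial ω) ≡ value φ X Y L₁ L₂
  Σ⊆-star-edges φ inv = ≡-trans
    (cong₂ _+_
      (≡-trans (by-leaves (φ ∘ monomial ω))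
        (by-complement λ s₁ t₁ s₂ t₂ p₁ p₂ → inv (monomial-uncentral s₁ t₁ s₂ t₂ p₁ p₂)))
      (≡-trans (≡-trans (by-leaves (φ ∘ monomial ω ∘ (edge c₁ c₂ ∷_)))
        (by-complement λ s₁ t₁ s₂ t₂ p₁ p₂ → inv (monomial-central s₁ t₁ s₂ t₂ p₁ p₂)))
        (≡-sym (Σ⊆-++ L₁ L₂ _))))
    -- `Σ⊆` puts the sets without its head, the central edge, first; `value` puts them last.
    (+-comm (Σ⊆ L₁ _) _)
    where
    by-leaves : ∀ g → Σ⊆ (map (edge c₁) l₁ ++ map (edge c₂) l₂) g
      ≡ Σ⊆ l₁ (λ s₁ → Σ⊆ l₂ (λ s₂ → g (map (edge c₁) s₁ ++ map (edge c₂) s₂)))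
    by-leaves g = ≡-trans (Σ⊆-++ (map (edge c₁) l₁) (map (edge c₂) l₂) g)
      (≡-trans (Σ⊆-map (edge c₁) l₁ _) (Σ⊆-cong l₁ λ s₁ → Σ⊆-map (edge c₂) l₂ _))
    by-complement : ∀ {g : List (Fin n) → List (Fin n) → ℕ} {h : List ℕ → List ℕ → ℕ} →
      (∀ s₁ t₁ s₂ t₂ → s₁ ++ t₁ ↭ l₁ → s₂ ++ t₂ ↭ l₂ → g s₁ s₂ ≡ h (map ω t₁) (map ω t₂)) →
      Σ⊆ l₁ (λ s₁ → Σ⊆ l₂ (g s₁)) ≡ Σ⊆ L₁ (λ t₁ → Σ⊆ L₂ (h t₁))
    by-complement {h = h} e = ≡-trans
      (Σ⊆-complement l₁ λ s₁ t₁ p₁ → ≡-trans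
        (Σ⊆-complement l₂ λ s₂ t₂ p₂ → e s₁ t₁ s₂ t₂ p₁ p₂)
        (≡-sym (Σ⊆-map ω l₂ (h (map ω t₁)))))
      (≡-sym (Σ⊆-map ω l₁ _))

-- The structure of a 2-star

edge-< : ∀ {n} {u v : Fin n} → u Fin.< v → edge u v ≡ (u , v)
edge-< {u = u} {v} u<v = cong (if_then (u , v) else (v , u)) (dec-true (u Fin.<? v) u<v)

edge-> : ∀ {n} {u v : Fin n} → v Fin.< u → edge u v ≡ (v , u)
edge-> {u = u} {v} v<u = cong (if_then (u , v) else (v , u)) (dec-false (u Fin.<? v) (<-asym v<u))

edge-injective : ∀ {n} (u v u' v' : Fin n) → edge u v ≡ edge u' v' →
                 (u ≡ u' × v ≡ v') ⊎ (u ≡ v' × v ≡ u')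
edge-injective u v u' v' e with edge-cases u v | edge-cases u' v'
... | inj₁ p | inj₁ q with ≡-trans (≡-sym p) (≡-trans e q)
...   | refl = inj₁ (refl , refl)
edge-injective u v u' v' e | inj₁ p | inj₂ q with ≡-trans (≡-sym p) (≡-trans e q)
...   | refl = inj₂ (refl , refl)
edge-injective u v u' v' e | inj₂ p | inj₁ q with ≡-trans (≡-sym p) (≡-trans e q)
...   | refl = inj₂ (refl , refl)
edge-injective u v u' v' e | inj₂ p | inj₂ q with ≡-trans (≡-sym p) (≡-trans e q)
...   | refl = inj₁ (refl , refl)

module _ {n} (G : SimpleGraph n) where

  adj⇒≢ : ∀ {u v} → adj G u v ≡ true → u ≢ v
  adj⇒≢ {u} a refl with ≡-trans (≡-sym a) (irrefl G u)
  ... | ()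

  adj-sym : ∀ {u v} → adj G u v ≡ true → adj G v u ≡ true
  adj-sym {u} {v} a = ≡-trans (sym G v u) a

  edges-unique : Unique (edges G)
  edges-unique = Unique.concat⁺
    (All.map⁺ (All.universal (λ i → Unique.map⁺ (cong proj₂)
      (Unique.filter⁺ _ (Unique.filter⁺ _ (Unique.allFin⁺ n)))) (allFin n)))
    (AllPairs.map⁺ (AllPairs.map
      (λ i≢j {_} (p , q) → i≢j (≡-trans (≡-sym (first p)) (first q))) (Unique.allFin⁺ n)))
    where
    first : ∀ {i xs} {e : Fin n × Fin n} → e ∈ map (i ,_) xs → proj₁ e ≡ i
    first p with ∈-map⁻ (_ ,_) p
    ... | _ , _ , refl = refl

  ∈-edges⁻ : ∀ {i j} → (i , j) ∈ edges G → i Fin.< j × adj G i j ≡ true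
  ∈-edges⁻ e with find (∈-concatMap⁻ _ {xs = allFin n} e)
  ... | i , _ , e' with ∈-map⁻ (i ,_) e'
  ...   | j , j∈ , refl with ∈-filter⁻ (i Fin.<?_) {xs = filter (λ j → adj G i j Bool.≟ true) (allFin n)} j∈
  ...     | j∈' , i<j = i<j , proj₂ (∈-filter⁻ (λ j → adj G i j Bool.≟ true) {xs = allFin n} j∈')

  ∈-edges⁺ : ∀ {i j} → i Fin.< j → adj G i j ≡ true → (i , j) ∈ edges G
  ∈-edges⁺ {i} {j} i<j a = ∈-concatMap⁺ _ (lose (∈-allFin i) (∈-map⁺ (i ,_)
    (∈-filter⁺ (i Fin.<?_) (∈-filter⁺ (λ j → adj G i j Bool.≟ true) (∈-allFin j) a) i<j)))

  edge-∈-edges : ∀ {u v} → adj G u v ≡ true → edge u v ∈ edges G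
  edge-∈-edges {u} {v} a with Fin.<-cmp u v
  ... | tri< u<v _ _ = subst (_∈ edges G) (≡-sym (edge-< u<v)) (∈-edges⁺ u<v a)
  ... | tri≈ _ u≡v _ = ⊥-elim (adj⇒≢ a u≡v)
  ... | tri> _ _ v<u = subst (_∈ edges G) (≡-sym (edge-> v<u)) (∈-edges⁺ v<u (adj-sym a))

  leavesAt : Fin n → Fin n → List (Fin n)
  leavesAt c c' = filter (λ v → ¬? (v Fin.≟ c') ×-dec (adj G c v Bool.≟ true)) (allFin n)

  ∈-leavesAt⁺ : ∀ {c c' v} → v ≢ c' → adj G c v ≡ true → v ∈ leavesAt c c'
  ∈-leavesAt⁺ {v = v} ne a = ∈-filter⁺ _ (∈-allFin v) (ne , a)

  ∈-leavesAt⁻ : ∀ {c c' v} → v ∈ leavesAt c c' → v ≢ c' × adj G c v ≡ true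
  ∈-leavesAt⁻ v∈ = proj₂ (∈-filter⁻ _ {xs = allFin n} v∈)

  leavesAt-unique : ∀ c c' → Unique (leavesAt c c')
  leavesAt-unique c c' = Unique.filter⁺ _ (Unique.allFin⁺ n)

  -- By computation, the stars of the result are those of the argument in the other order, so this
  -- yields the second realisation and the crossed isomorphism.
  swapCentres : IsTwoStar G → IsTwoStar G
  swapCentres (c₁ , c₂ , ne , a , leaf , none , has₁ , has₂) =
    c₂ , c₁ , ne ∘ ≡-sym , adj-sym a ,
    (λ v n₂ n₁ → flip (leaf v n₁ n₂)) , (λ u v a b c d → none u v b a d c) , has₂ , has₁
    where
    flip : ∀ {A B C D : Set} → (A × B) ⊎ (C × D) → (D × C) ⊎ (B × A)
    flip (inj₁ (a , b)) = inj₂ (b , a)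
    flip (inj₂ (c , d)) = inj₁ (d , c)

-- Adjacency in a 2-star depends only on the kinds of the two vertices, so a bijection that
-- preserves kinds is a graph isomorphism.
data Kind : Set where
  centre₁ centre₂ leaf₁ leaf₂ : Kind

adjᴷ : Kind → Kind → Bool
adjᴷ centre₁ centre₂ = true
adjᴷ centre₁ leaf₁   = true
adjᴷ centre₂ centre₁ = true
adjᴷ centre₂ leaf₂   = true
adjᴷ leaf₁   centre₁ = true
adjᴷ leaf₂   centre₂ = true
adjᴷ _       _       = false

module TwoStar {n} (G : SimpleGraph n) (ts : IsTwoStar G) where

  c₁ = proj₁ ts
  c₂ = proj₁ (proj₂ ts)

  l₁ l₂ : List (Fin n)
  l₁ = leavesAt G c₁ c₂
  l₂ = leavesAt G c₂ c₁

  private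
    c₁≢c₂ : c₁ ≢ c₂
    c₁≢c₂ = proj₁ (proj₂ (proj₂ ts))

    central : adj G c₁ c₂ ≡ true
    central = proj₁ (proj₂ (proj₂ (proj₂ ts)))

    attached = proj₁ (proj₂ (proj₂ (proj₂ (proj₂ ts))))
    leaves-nonadjacent = proj₁ (proj₂ (proj₂ (proj₂ (proj₂ (proj₂ ts)))))
    has-leaf₁ = proj₁ (proj₂ (proj₂ (proj₂ (proj₂ (proj₂ (proj₂ ts))))))
    has-leaf₂ = proj₂ (proj₂ (proj₂ (proj₂ (proj₂ (proj₂ (proj₂ ts))))))

    true≢false : ∀ {b} → b ≡ true → b ≢ false
    true≢false refl ()

  nonempty₁ : 1 ≤ length l₁
  nonempty₁ = ∈-length (∈-leavesAt⁺ G (proj₁ (proj₂ has-leaf₁)) (proj₂ (proj₂ has-leaf₁)))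

  nonempty₂ : 1 ≤ length l₂
  nonempty₂ = ∈-length (∈-leavesAt⁺ G (proj₁ (proj₂ has-leaf₂)) (proj₂ (proj₂ has-leaf₂)))

  data HasKind (v : Fin n) : Kind → Set where
    is-c₁ : v ≡ c₁ → HasKind v centre₁
    is-c₂ : v ≡ c₂ → HasKind v centre₂
    in-l₁ : v ≢ c₁ → v ≢ c₂ → adj G c₁ v ≡ true → adj G c₂ v ≡ false → HasKind v leaf₁
    in-l₂ : v ≢ c₁ → v ≢ c₂ → adj G c₁ v ≡ false → adj G c₂ v ≡ true → HasKind v leaf₂

  classify : ∀ v → ∃ (HasKind v)
  classify v with v Fin.≟ c₁ | v Fin.≟ c₂
  ... | yes p | _     = centre₁ , is-c₁ p
  ... | no _  | yes q = centre₂ , is-c₂ q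
  ... | no p  | no q with attached v p q
  ...   | inj₁ (a , b) = leaf₁ , in-l₁ p q a b
  ...   | inj₂ (a , b) = leaf₂ , in-l₂ p q a b

  kind : Fin n → Kind
  kind = proj₁ ∘ classify

  kind-unique : ∀ {v k k'} → HasKind v k → HasKind v k' → k ≡ k'
  kind-unique (is-c₁ _) (is-c₁ _) = refl
  kind-unique (is-c₁ p) (is-c₂ q) = ⊥-elim (c₁≢c₂ (≡-trans (≡-sym p) q))
  kind-unique (is-c₁ p) (in-l₁ q _ _ _) = ⊥-elim (q p)
  kind-unique (is-c₁ p) (in-l₂ q _ _ _) = ⊥-elim (q p)
  kind-unique (is-c₂ p) (is-c₁ q) = ⊥-elim (c₁≢c₂ (≡-trans (≡-sym q) p))
  kind-unique (is-c₂ _) (is-c₂ _) = refl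
  kind-unique (is-c₂ p) (in-l₁ _ q _ _) = ⊥-elim (q p)
  kind-unique (is-c₂ p) (in-l₂ _ q _ _) = ⊥-elim (q p)
  kind-unique (in-l₁ q _ _ _) (is-c₁ p) = ⊥-elim (q p)
  kind-unique (in-l₁ _ q _ _) (is-c₂ p) = ⊥-elim (q p)
  kind-unique (in-l₁ _ _ _ _) (in-l₁ _ _ _ _) = refl
  kind-unique (in-l₁ _ _ a _) (in-l₂ _ _ b _) = ⊥-elim (true≢false a b)
  kind-unique (in-l₂ q _ _ _) (is-c₁ p) = ⊥-elim (q p)
  kind-unique (in-l₂ _ q _ _) (is-c₂ p) = ⊥-elim (q p)
  kind-unique (in-l₂ _ _ b _) (in-l₁ _ _ a _) = ⊥-elim (true≢false a b)
  kind-unique (in-l₂ _ _ _ _) (in-l₂ _ _ _ _) = refl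

  kind-≡ : ∀ {v k} → HasKind v k → kind v ≡ k
  kind-≡ {v} = kind-unique (proj₂ (classify v))

  adj-kind : ∀ {u v k k'} → HasKind u k → HasKind v k' → adj G u v ≡ adjᴷ k k'
  adj-kind (is-c₁ refl) (is-c₁ refl) = irrefl G c₁
  adj-kind (is-c₁ refl) (is-c₂ refl) = central
  adj-kind (is-c₁ refl) (in-l₁ _ _ a _) = a
  adj-kind (is-c₁ refl) (in-l₂ _ _ a _) = a
  adj-kind (is-c₂ refl) (is-c₁ refl) = adj-sym G central
  adj-kind (is-c₂ refl) (is-c₂ refl) = irrefl G c₂
  adj-kind (is-c₂ refl) (in-l₁ _ _ _ b) = b
  adj-kind (is-c₂ refl) (in-l₂ _ _ _ b) = b
  adj-kind (in-l₁ _ _ a _) (is-c₁ refl) = ≡-trans (sym G _ c₁) a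
  adj-kind (in-l₁ _ _ _ b) (is-c₂ refl) = ≡-trans (sym G _ c₂) b
  adj-kind (in-l₂ _ _ a _) (is-c₁ refl) = ≡-trans (sym G _ c₁) a
  adj-kind (in-l₂ _ _ _ b) (is-c₂ refl) = ≡-trans (sym G _ c₂) b
  adj-kind (in-l₁ p q _ _) (in-l₁ r s _ _) = leaves-nonadjacent _ _ p q r s
  adj-kind (in-l₁ p q _ _) (in-l₂ r s _ _) = leaves-nonadjacent _ _ p q r s
  adj-kind (in-l₂ p q _ _) (in-l₁ r s _ _) = leaves-nonadjacent _ _ p q r s
  adj-kind (in-l₂ p q _ _) (in-l₂ r s _ _) = leaves-nonadjacent _ _ p q r s

  adj-by-kind : ∀ u v → adj G u v ≡ adjᴷ (kind u) (kind v)
  adj-by-kind u v = adj-kind (proj₂ (classify u)) (proj₂ (classify v))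

  l₁-kind : ∀ {v} → v ∈ l₁ → HasKind v leaf₁
  l₁-kind {v} v∈ with ∈-leavesAt⁻ G v∈ | classify v
  ... | ne , a | _ , is-c₁ p         = ⊥-elim (adj⇒≢ G a (≡-sym p))
  ... | ne , a | _ , is-c₂ p         = ⊥-elim (ne p)
  ... | ne , a | _ , k@(in-l₁ _ _ _ _) = k
  ... | ne , a | _ , in-l₂ _ _ b _   = ⊥-elim (true≢false a b)

  l₂-kind : ∀ {v} → v ∈ l₂ → HasKind v leaf₂
  l₂-kind {v} v∈ with ∈-leavesAt⁻ G v∈ | classify v
  ... | ne , a | _ , is-c₂ p         = ⊥-elim (adj⇒≢ G a (≡-sym p))
  ... | ne , a | _ , is-c₁ p         = ⊥-elim (ne p)
  ... | ne , a | _ , k@(in-l₂ _ _ _ _) = k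
  ... | ne , a | _ , in-l₁ _ _ _ b   = ⊥-elim (true≢false a b)

  all-vertices : c₁ ∷ c₂ ∷ l₁ ++ l₂ ↭ allFin n
  all-vertices = unique-set⇒↭ distinct (Unique.allFin⁺ n) (λ {v} _ → ∈-allFin v) (λ {v} _ → listed v)
    where
    l₁l₂ : ∀ {v} → v ∈ l₁ ++ l₂ → HasKind v leaf₁ ⊎ HasKind v leaf₂
    l₁l₂ v∈ with ∈-++⁻ l₁ v∈
    ... | inj₁ i = inj₁ (l₁-kind i)
    ... | inj₂ i = inj₂ (l₂-kind i)
    c₁∉ : ∀ {v} → v ∈ l₁ ++ l₂ → c₁ ≢ v
    c₁∉ v∈ refl with l₁l₂ v∈
    ... | inj₁ (in-l₁ p _ _ _) = p refl
    ... | inj₂ (in-l₂ p _ _ _) = p refl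
    c₂∉ : ∀ {v} → v ∈ l₁ ++ l₂ → c₂ ≢ v
    c₂∉ v∈ refl with l₁l₂ v∈
    ... | inj₁ (in-l₁ _ p _ _) = p refl
    ... | inj₂ (in-l₂ _ p _ _) = p refl
    distinct : Unique (c₁ ∷ c₂ ∷ l₁ ++ l₂)
    distinct = (c₁≢c₂ ∷ All.tabulate c₁∉) ∷ All.tabulate c₂∉ ∷
      Unique.++⁺ (leavesAt-unique G c₁ c₂) (leavesAt-unique G c₂ c₁) apart
      where
      apart : ∀ {v} → v ∈ l₁ × v ∈ l₂ → ⊥
      apart (i , j) with kind-unique (l₁-kind i) (l₂-kind j)
      ... | ()
    listed : ∀ v → v ∈ c₁ ∷ c₂ ∷ l₁ ++ l₂
    listed v with classify v
    ... | _ , is-c₁ p         = here p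
    ... | _ , is-c₂ p         = there (here p)
    ... | _ , in-l₁ _ q a _   = there (there (∈-++⁺ˡ (∈-leavesAt⁺ G q a)))
    ... | _ , in-l₂ p _ _ b   = there (there (∈-++⁺ʳ l₁ (∈-leavesAt⁺ G p b)))

  -- Neither list has repetitions, so comparing members suffices. Having `c₂` ahead of `l₁` makes
  -- the central edge the head.
  edges-↭ : edges G ↭ map (edge c₁) (c₂ ∷ l₁) ++ map (edge c₂) l₂
  edges-↭ = unique-set⇒↭ (edges-unique G)
    (Unique.++⁺ (Unique.map⁺ (inj c₁) (All.tabulate c₂∉ ∷ leavesAt-unique G c₁ c₂))
                (Unique.map⁺ (inj c₂) (leavesAt-unique G c₂ c₁)) apart)
    ⊆ ⊇
    where
    c₂∉ : ∀ {v} → v ∈ l₁ → c₂ ≢ v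
    c₂∉ v∈ refl = proj₁ (∈-leavesAt⁻ G v∈) refl
    inj : ∀ c {u v} → edge c u ≡ edge c v → u ≡ v
    inj c {u} {v} e with edge-injective c u c v e
    ... | inj₁ (_ , q) = q
    ... | inj₂ (p , q) = ≡-trans q p
    apart : ∀ {e} → e ∈ map (edge c₁) (c₂ ∷ l₁) × e ∈ map (edge c₂) l₂ → ⊥
    apart (i , j) with ∈-map⁻ (edge c₁) i | ∈-map⁻ (edge c₂) j
    ... | u , _ , p | v , v∈ , q with edge-injective c₁ u c₂ v (≡-trans (≡-sym p) q)
    ...   | inj₁ (e , _) = c₁≢c₂ e
    ...   | inj₂ (e , _) = proj₁ (∈-leavesAt⁻ G v∈) (≡-sym e)
    at₁ : ∀ {u} → u ∈ c₂ ∷ l₁ → edge c₁ u ∈ map (edge c₁) (c₂ ∷ l₁) ++ map (edge c₂) l₂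
    at₁ u∈ = ∈-++⁺ˡ (∈-map⁺ (edge c₁) u∈)
    at₂ : ∀ {u} → u ∈ l₂ → edge c₂ u ∈ map (edge c₁) (c₂ ∷ l₁) ++ map (edge c₂) l₂
    at₂ u∈ = ∈-++⁺ʳ (map (edge c₁) (c₂ ∷ l₁)) (∈-map⁺ (edge c₂) u∈)
    ⊆ : ∀ {e} → e ∈ edges G → e ∈ map (edge c₁) (c₂ ∷ l₁) ++ map (edge c₂) l₂
    ⊆ {i , j} e∈ with ∈-edges⁻ G e∈
    ... | i<j , a = incident (classify i) (classify j)
      where
      E : Fin n × Fin n → Set
      E = _∈ map (edge c₁) (c₂ ∷ l₁) ++ map (edge c₂) l₂
      incident : ∃ (HasKind i) → ∃ (HasKind j) → E (i , j)
      incident (_ , is-c₁ refl) (_ , is-c₁ refl) = ⊥-elim (adj⇒≢ G a refl)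
      incident (_ , is-c₁ refl) (_ , is-c₂ refl) = subst E (edge-< i<j) (at₁ (here refl))
      incident (_ , is-c₁ refl) (_ , in-l₁ _ q b _) = subst E (edge-< i<j) (at₁ (there (∈-leavesAt⁺ G q b)))
      incident (_ , is-c₁ refl) (_ , in-l₂ _ _ b _) = ⊥-elim (true≢false a b)
      incident (_ , is-c₂ refl) (_ , is-c₁ refl) = subst E (edge-> i<j) (at₁ (here refl))
      incident (_ , is-c₂ refl) (_ , is-c₂ refl) = ⊥-elim (adj⇒≢ G a refl)
      incident (_ , is-c₂ refl) (_ , in-l₁ _ _ _ b) = ⊥-elim (true≢false a b)
      incident (_ , is-c₂ refl) (_ , in-l₂ p _ _ b) = subst E (edge-< i<j) (at₂ (∈-leavesAt⁺ G p b))
      incident (_ , in-l₁ _ q b _) (_ , is-c₁ refl) = subst E (edge-> i<j) (at₁ (there (∈-leavesAt⁺ G q b)))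
      incident (_ , in-l₁ _ _ _ b) (_ , is-c₂ refl) = ⊥-elim (true≢false (adj-sym G a) b)
      incident (_ , in-l₂ _ _ b _) (_ , is-c₁ refl) = ⊥-elim (true≢false (adj-sym G a) b)
      incident (_ , in-l₂ p _ _ b) (_ , is-c₂ refl) = subst E (edge-> i<j) (at₂ (∈-leavesAt⁺ G p b))
      incident (_ , k@(in-l₁ _ _ _ _)) (_ , k'@(in-l₁ _ _ _ _)) = ⊥-elim (true≢false a (adj-kind k k'))
      incident (_ , k@(in-l₁ _ _ _ _)) (_ , k'@(in-l₂ _ _ _ _)) = ⊥-elim (true≢false a (adj-kind k k'))
      incident (_ , k@(in-l₂ _ _ _ _)) (_ , k'@(in-l₁ _ _ _ _)) = ⊥-elim (true≢false a (adj-kind k k'))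
      incident (_ , k@(in-l₂ _ _ _ _)) (_ , k'@(in-l₂ _ _ _ _)) = ⊥-elim (true≢false a (adj-kind k k'))
    ⊇ : ∀ {e} → e ∈ map (edge c₁) (c₂ ∷ l₁) ++ map (edge c₂) l₂ → e ∈ edges G
    ⊇ e∈ with ∈-++⁻ (map (edge c₁) (c₂ ∷ l₁)) e∈
    ... | inj₁ i with ∈-map⁻ (edge c₁) i
    ...   | _ , here refl , refl = edge-∈-edges G central
    ...   | _ , there u∈  , refl = edge-∈-edges G (proj₂ (∈-leavesAt⁻ G u∈))
    ⊇ e∈ | inj₂ i with ∈-map⁻ (edge c₂) i
    ...   | _ , u∈ , refl = edge-∈-edges G (proj₂ (∈-leavesAt⁻ G u∈))

  star₁ star₂ : (Fin n → ℕ) → Star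
  star₁ ω = star (ω c₁) (map ω l₁)
  star₂ ω = star (ω c₂) (map ω l₂)

  leafy₁ : ∀ ω → Leafy (star₁ ω)
  leafy₁ ω = subst (1 ≤_) (≡-sym (length-map ω l₁)) nonempty₁

  leafy₂ : ∀ ω → Leafy (star₂ ω)
  leafy₂ ω = subst (1 ≤_) (≡-sym (length-map ω l₂)) nonempty₂

  M-realises : ∀ ω → Realises (λ φ → sum (map φ (M G (mω ω)))) (star₁ ω) (star₂ ω)
  M-realises ω = realises λ φ inv → ≡-trans (cong sum (≡-sym (map-∘ (subsets (edges G)))))
    (≡-trans (Σ⊆-subsets (edges G) (φ ∘ monomial ω))
    (≡-trans (Σ⊆-↭ (λ p → cong φ (monomial-↭ p ω)) edges-↭)
             (Σ⊆-star-edges ω c₁ c₂ l₁ l₂ all-vertices nonempty₁ nonempty₂ φ inv)))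

  label : (Fin n → ℕ) → Fin n → Kind × ℕ
  label ω v = kind v , ω v

  labels-↭ : ∀ ω → map (label ω) (allFin n) ↭
    (centre₁ , ω c₁) ∷ (centre₂ , ω c₂) ∷ map (leaf₁ ,_) (map ω l₁) ++ map (leaf₂ ,_) (map ω l₂)
  labels-↭ ω = ↭-trans (map⁺ (label ω) (↭-sym all-vertices)) (↭-reflexive
    (cong₂ _∷_ (cong (_, ω c₁) (kind-≡ (is-c₁ refl)))
    (cong₂ _∷_ (cong (_, ω c₂) (kind-≡ (is-c₂ refl)))
    (≡-trans (map-++ (label ω) l₁ l₂)
      (cong₂ _++_ (labels l₁ (kind-≡ ∘ l₁-kind)) (labels l₂ (kind-≡ ∘ l₂-kind)))))))
    where
    labels : ∀ {k} l → (∀ {v} → v ∈ l → kind v ≡ k) → map (label ω) l ≡ map (k ,_) (map ω l)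
    labels []      h = refl
    labels (v ∷ l) h = cong₂ _∷_ (cong (_, ω v) (h (here refl))) (labels l (h ∘ there))

-- From equal polynomials to an isomorphism of weighted trees.

sum-≈P : ∀ {φ} → Invariant φ → ∀ {P Q} → P ≈P Q → sum (map φ P) ≡ sum (map φ Q)
sum-≈P {φ} inv (Homogeneous.refl e) = pointwise e
  where
  pointwise : ∀ {P Q} → Pointwise _↭_ P Q → sum (map φ P) ≡ sum (map φ Q)
  pointwise []      = refl
  pointwise (p ∷ e) = cong₂ _+_ (inv p) (pointwise e)
sum-≈P inv (Homogeneous.prep p e) = cong₂ _+_ (inv p) (sum-≈P inv e)
sum-≈P {φ} inv (Homogeneous.swap {xs = P} {x = x} {y = y} p q e) = ≡-trans
  (+-x∙yz≈y∙xz (φ x) (φ y) (sum (map φ P)))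
  (cong₂ _+_ (inv q) (cong₂ _+_ (inv p) (sum-≈P inv e)))
sum-≈P inv (Homogeneous.trans e f) = ≡-trans (sum-≈P inv e) (sum-≈P inv f)

-- A permutation of the lists of labels matches their positions, and the positions are the vertices
-- up to a cast along the lengths.
labels-bijection : ∀ {X : Set} {n n'} (f : Fin n → X) (f' : Fin n' → X) →
  map f (allFin n) ↭ map f' (allFin n') →
  Σ (Fin n ↔ Fin n') λ π → ∀ v → f v ≡ f' (Inverse.to π v)
labels-bijection {X} {n} {n'} f f' p = π , agree
  where
  q : tabulate f ↭ tabulate f'
  q = subst₂ _↭_ (map-tabulate (λ i → i) f) (map-tabulate (λ i → i) f') p
  σ = Homogeneous.onIndices (↭⇒↭ₛ q)
  π : Fin n ↔ Fin n'
  π = (cast-id (≡-sym (length-tabulate f)) ∘ₚ σ) ∘ₚ cast-id (length-tabulate f')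
  lookup-cast : ∀ {m} (g : Fin m → X) (e : length (tabulate g) ≡ m) i → lookup (tabulate g) i ≡ g (Fin.cast e i)
  lookup-cast {suc m} g e Fin.zero    = refl
  lookup-cast {suc m} g e (Fin.suc i) = lookup-cast (g ∘ Fin.suc) (suc-injective e) i
  agree : ∀ v → f v ≡ f' (Inverse.to π v)
  agree v = ≡-trans (≡-sym (lookup-tabulate f v)) (≡-trans
    (Permutationₛ.onIndices-lookup (setoid X) (↭⇒↭ₛ q) _)
    (lookup-cast f' (length-tabulate f') _))

-- Matching stars give the same multiset of pairs of kind and weight, hence a bijection preserving
-- both; kinds determine adjacency.
≅⇒ωIso : ∀ {n n'} (T : SimpleGraph n) (ω : Fin n → ℕ) (T' : SimpleGraph n') (ω' : Fin n' → ℕ)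
  (ts : IsTwoStar T) (ts' : IsTwoStar T') →
  TwoStar.star₁ T ts ω ≅ TwoStar.star₁ T' ts' ω' → TwoStar.star₂ T ts ω ≅ TwoStar.star₂ T' ts' ω' →
  ωIso T ω T' ω'
≅⇒ωIso {n} {n'} T ω T' ω' ts ts' (e₁ , p₁) (e₂ , p₂) =
  f , (λ u v → ≡-trans (A.adj-by-kind u v)
        (≡-trans (cong₂ adjᴷ (cong proj₁ (agree u)) (cong proj₁ (agree v)))
                 (≡-sym (B.adj-by-kind (Inverse.to f u) (Inverse.to f v))))) ,
      (cong proj₂ ∘ agree)
  where
  module A = TwoStar T ts
  module B = TwoStar T' ts'
  labels : map (A.label ω) (allFin n) ↭ map (B.label ω') (allFin n')
  labels = ↭-trans (A.labels-↭ ω) (↭-trans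
    (↭-trans (↭-reflexive (cong₂ (λ a b → (centre₁ , a) ∷ (centre₂ , b) ∷ _) e₁ e₂))
             (prep _ (prep _ (++⁺ (map⁺ (leaf₁ ,_) p₁) (map⁺ (leaf₂ ,_) p₂)))))
    (↭-sym (B.labels-↭ ω')))
  bijection = labels-bijection (A.label ω) (B.label ω') labels
  f = proj₁ bijection
  agree = proj₂ bijection

theorem7p8 : ∀ {n n'} (T : SimpleGraph n) (ω : Fin n → ℕ) (T' : SimpleGraph n') (ω' : Fin n' → ℕ) →
    IsTwoStar T → IsWeight ω → IsTwoStar T' → IsWeight ω' →
    M T (mω ω) ≈P M T' (mω ω') →
    ωIso T ω T' ω'
theorem7p8 T ω T' ω' ts _ ts' _ M≈M' = [ straight , crossed ]′ (reconstruction
    (A.M-realises ω) (TwoStar.M-realises T (swapCentres T ts) ω)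
    (transfer (B.M-realises ω')) (transfer (TwoStar.M-realises T' (swapCentres T' ts') ω'))
    (A.leafy₁ ω) (A.leafy₂ ω) (B.leafy₁ ω') (B.leafy₂ ω'))
  where
  module A = TwoStar T ts
  module B = TwoStar T' ts'
  -- The equality of the polynomials enters here: the stars of `T'` realise the sums over the
  -- monomials of `T`.
  transfer : ∀ {S₁ S₂} → Realises (λ φ → sum (map φ (M T' (mω ω')))) S₁ S₂ →
                         Realises (λ φ → sum (map φ (M T (mω ω)))) S₁ S₂
  transfer r = realises λ φ inv → ≡-trans (sum-≈P inv M≈M') (Realises.value-at r φ inv)
  straight : A.star₁ ω ≅ B.star₁ ω' × A.star₂ ω ≅ B.star₂ ω' → ωIso T ω T' ω'
  straight (s₁ , s₂) = ≅⇒ωIso T ω T' ω' ts ts' s₁ s₂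
  crossed : A.star₁ ω ≅ B.star₂ ω' × A.star₂ ω ≅ B.star₁ ω' → ωIso T ω T' ω'
  -- A crossed match is a straight one after the centres of `T'` are exchanged.
  crossed (s₁ , s₂) = ≅⇒ωIso T ω T' ω' ts (swapCentres T' ts') s₁ s₂
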